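{- Let $l\geq 0$ and $d\geq 1$ be integers, and let $\boldsymbol{\varepsilon}=(\varepsilon_i)_{i\geq 0}$ be a sequence of non-constant polynomials in $\mathbb{F}_2[t]$ which is ultimately periodic of type $(l,d)$. Let $\mathbf{s}(\boldsymbol{\varepsilon})=(s_i)_{i\geq 0}$ be the sequence associated to $\boldsymbol{\varepsilon}$ as described in the context, and let $\alpha=[s_0,s_1,s_2,\dots]\in\mathbb{F}_2((1/t))$ be the infinite continued fraction with partial quotients $s_i$. Then there is a polynomial $P\in\mathbb{F}_2(\boldsymbol{\varepsilon})[x]$ with $\deg_x(P)=2^d$ and $P(\alpha)=0$. More precisely, setting $\beta=1/\alpha$, there are $d+1$ elements $A$ and $B_k$ ($0\leq k\leq d-1$) of $\mathbb{F}_2(\boldsymbol{\varepsilon})$ such that $$\beta^{2^d}=A+\sum_{0\leq k\leq d-1}B_k\,\beta^{2^k}.$$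
   Context: A sequence $\boldsymbol{\varepsilon}=(\varepsilon_i)_{i\geq 0}$ is called ultimately periodic of type $(l,d)$ (with $l\geq 0$, $d\geq 1$ integers) if: when $l=0$, it is purely periodic with period of length $d$, i.e. $\boldsymbol{\varepsilon}=(\varepsilon_0,\dots,\varepsilon_{d-1})^\infty$; when $l>0$, it consists of a prefix $\varepsilon_0,\dots,\varepsilon_{l-1}$ of length $l$ followed by the repeated period $(\varepsilon_l,\dots,\varepsilon_{l+d-1})^\infty$, i.e. $\varepsilon_{n+d}=\varepsilon_n$ for all $n\geq l$. Construction of $\mathbf{s}(\boldsymbol{\varepsilon})$: let $W_0$ be the empty word and, for $n\geq 0$, let $W_{n+1}=W_n\,\varepsilon_n\,W_n$ (concatenation). Each $W_{n+1}$ begins with $W_n$, and $\mathbf{s}(\boldsymbol{\varepsilon})$ is the infinite word beginning with $W_n$ for every $n$; thus $\mathbf{s}(\boldsymbol{\varepsilon})=\varepsilon_0\varepsilon_1\varepsilon_0\varepsilon_2\varepsilon_0\varepsilon_1\varepsilon_0\varepsilon_3\varepsilon_0\cdots$. The continued fraction $[s_0,s_1,\dots]$ denotes $s_0+1/(s_1+1/(s_2+\cdots))$, the limit in the field $\mathbb{F}_2((1/t))$ of Laurent series in $1/t$ of its convergents $[s_0,\dots,s_{n-1}]$. $\mathbb{F}_2(\boldsymbol{\varepsilon})$ denotes the subfield of $\mathbb{F}_2(t)$ generated by $\varepsilon_0,\varepsilon_1,\dots,\varepsilon_{l+d-1}$. -}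

module Defs where

open import Data.Bool using (Bool; true; false; _xor_; _∧_; if_then_else_)
open import Data.Nat using (ℕ; zero; suc; _+_; _∸_; _≤_; _<_; _⊔_; _≤ᵇ_; _^_)
open import Data.Integer as ℤ using (ℤ; +_)
open import Data.List using (List; []; _∷_; _++_; length; map)
open import Data.Product using (_×_; _,_; ∃; ∃-syntax; Σ)
open import Relation.Binary.PropositionalEquality using (_≡_)
open import Relation.Nullary using (yes; no)

-- Polynomials in F₂[t]: little-endian coefficient lists (trailing zeros
-- allowed); equality is coefficientwise.

Poly : Set
Poly = List Bool

coeffP : Poly → ℕ → Bool
coeffP []      _       = false
coeffP (b ∷ p) zero    = b
coeffP (b ∷ p) (suc n) = coeffP p n

0P 1P : Poly
0P = []
1P = true ∷ []

infixl 6 _+P_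
infixl 7 _*P_
_+P_ : Poly → Poly → Poly
[]      +P q       = q
(a ∷ p) +P []      = a ∷ p
(a ∷ p) +P (b ∷ q) = (a xor b) ∷ (p +P q)

_·P_ : Bool → Poly → Poly
b ·P p = map (b ∧_) p

_*P_ : Poly → Poly → Poly
[]      *P q = []
(a ∷ p) *P q = (a ·P q) +P (false ∷ (p *P q))

infix 4 _≈P_
_≈P_ : Poly → Poly → Set
p ≈P q = ∀ n → coeffP p n ≡ coeffP q n

NonZeroP : Poly → Set
NonZeroP p = ∃[ n ] coeffP p n ≡ true

NonConst : Poly → Set
NonConst p = ∃[ n ] (1 ≤ n × coeffP p n ≡ true)

UltPeriodic : ℕ → ℕ → (ℕ → Poly) → Set
UltPeriodic l d ε = 1 ≤ d × (∀ n → l ≤ n → ε (n + d) ≈P ε n)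

W : (ℕ → Poly) → ℕ → List Poly
W ε zero    = []
W ε (suc n) = W ε n ++ (ε n ∷ W ε n)

nth : {A : Set} → List A → ℕ → A → A
nth []       _       a = a
nth (x ∷ xs) zero    a = x
nth (x ∷ xs) (suc n) a = nth xs n a

-- s_i is the i-th letter of W_{i+1} (which has length 2^{i+1} - 1 > i),
-- hence the i-th letter of every W_n with n > i.
sSeq : (ℕ → Poly) → ℕ → Poly
sSeq ε i = nth (W ε (suc i)) i 0P

-- F₂(t) as pairs (numerator , denominator)

RatF : Set
RatF = Poly × Poly

-- finite continued fraction [s_i , s_{i+1} , … , s_{i+n}] computed
-- literally: [a] = a/1 and [a , rest] = a + 1/[rest].
cfFrom : (ℕ → Poly) → ℕ → ℕ → RatF
cfFrom s i zero    = s i , 1P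
cfFrom s i (suc n) with cfFrom s (suc i) n
... | p , q = s i *P p +P q , p

convergent : (ℕ → Poly) → ℕ → RatF
convergent s n = cfFrom s 0 n

-- The subfield F₂(ε_0 , … , ε_{K-1}) of F₂(t): smallest subset containing
-- 0, 1, the ε_i (i < K), closed under +, ·, inverses of nonzero elements,
-- and under equality of rational functions.  (In characteristic 2, -x = x.)
data InF (ε : ℕ → Poly) (K : ℕ) : RatF → Set where
  gen  : ∀ i → i < K → InF ε K (ε i , 1P)
  zer  : InF ε K (0P , 1P)
  one  : InF ε K (1P , 1P)
  add  : ∀ {p q p' q'} → InF ε K (p , q) → InF ε K (p' , q') →
         InF ε K (p *P q' +P p' *P q , q *P q')
  mul  : ∀ {p q p' q'} → InF ε K (p , q) → InF ε K (p' , q') →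
         InF ε K (p *P p' , q *P q')
  inv  : ∀ {p q} → InF ε K (p , q) → NonZeroP p → InF ε K (q , p)
  resp : ∀ {p q p' q'} → InF ε K (p , q) → NonZeroP q' →
         p *P q' ≈P p' *P q → InF ε K (p' , q')

-- Laurent series in 1/t over F₂:  mkL N c  denotes  Σ_{j≥0} c j · t^(N - j)

record Laurent : Set where
  constructor mkL
  field
    top : ℕ
    cf  : ℕ → Bool
open Laurent public

coeffL : Laurent → ℤ → Bool
coeffL (mkL N c) e with e ℤ.≤? + N
... | yes _ = c ℤ.∣ + N ℤ.- e ∣
... | no  _ = false

infix 4 _≈L_
_≈L_ : Laurent → Laurent → Set
x ≈L y = ∀ e → coeffL x e ≡ coeffL y e

bigXor : ℕ → (ℕ → Bool) → Bool
bigXor zero    f = false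
bigXor (suc n) f = bigXor n f xor f n

infixl 6 _+L_
infixl 7 _*L_
_+L_ : Laurent → Laurent → Laurent
x +L y = mkL N (λ j → coeffL x (+ N ℤ.- + j) xor coeffL y (+ N ℤ.- + j))
  where N = top x ⊔ top y

_*L_ : Laurent → Laurent → Laurent
x *L y = mkL (top x + top y)
             (λ j → bigXor (suc j) (λ i → cf x i ∧ cf y (j ∸ i)))

embedP : Poly → Laurent
embedP p = mkL (length p)
  (λ j → if j ≤ᵇ length p then coeffP p (length p ∸ j) else false)

zeroL oneL : Laurent
zeroL = mkL 0 (λ _ → false)
oneL  = embedP 1P

powL : Laurent → ℕ → Laurent
powL x zero    = oneL
powL x (suc n) = powL x n *L x

sumL : ℕ → (ℕ → Laurent) → Laurent
sumL zero    f = zeroL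
sumL (suc n) f = sumL n f +L f n

Represents : Laurent → RatF → Set
Represents x (p , q) = NonZeroP q × (embedP q *L x ≈L embedP p)

IsCFLimit : (ℕ → Poly) → Laurent → Set
IsCFLimit s α = ∀ m → ∃[ N ] (∀ n → N ≤ n → ∀ x → Represents x (convergent s n) →
                  ∀ e → ℤ.- (+ m) ℤ.≤ e → coeffL x e ≡ coeffL α e)

{-# OPTIONS --safe #-}
module Submission where

-- The matrix of W_n is (p_n q_n ; q_n r_n) with determinant 1, and W_{n+1} = W_n ε_n W_n gives
-- p_{n+1} = ε_n p_n² and q_{n+1} = ε_n p_n q_n + 1.  Hence the reciprocals q_n / p_n of the convergents are
-- the partial sums of 1/p_1 + 1/p_2 + ⋯, and 1/p_{n+1} = (1/p_n)² / ε_n.  Grouping the terms of index at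
-- least l + 1 by their residue modulo d gives series S_0, …, S_{d-1} with S_j² = ε_{l+j+1} S_{j+1} and
-- S_d = S_0 + 1/p_{l+1}.  So β lies in the span of 1, S_0, …, S_{d-1} over 𝔽₂(ε), which is stable under
-- squaring, and the d + 2 elements 1, β, β², β⁴, …, β^(2^d) of this space are linearly dependent.  The
-- first of them that depends on its predecessors yields, by repeated squaring, a relation for β^(2^d).
--
-- The series are summed in an extension of 𝔽₂((1/t)), the bounded sequences modulo the null sequences, and
-- only the resulting equation for α = 1/β descends to 𝔽₂((1/t)).

open import Algebra.Bundles using (CommutativeRing; RawRing)
open import Algebra.Morphism.Structures using (IsRingMonomorphism)
import Algebra.Solver.Ring as RingSolver
open import Algebra.Solver.Ring.AlmostCommutativeRing
  using (AlmostCommutativeRing; fromCommutativeSemiring; _-Raw-AlmostCommutative⟶_)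
open import Data.Bool using (Bool; true; false; T; _xor_; _∧_; if_then_else_)
import Data.Bool.Properties as Bool
open import Data.Bool.Solver using (module xor-∧-Solver)
open import Data.Empty using (⊥-elim)
open import Data.Integer using (ℤ; -[1+_])
import Data.Integer as ℤ
import Data.Integer.Properties as ℤ
open import Data.Integer.Tactic.RingSolver using (solve-∀)
open import Data.List using (List; []; _∷_; _++_; length; foldr)
import Data.List.Properties as List
open import Data.Maybe.Base using (just; nothing)
open import Data.Nat using (ℕ; zero; suc; _≤_; _<_; _<?_; z≤n; s≤s; s≤s⁻¹)
import Data.Nat as ℕ
open import Data.Nat.Induction using (<-rec)
import Data.Nat.Properties as ℕ
open import Data.Product using (_×_; _,_; ∃-syntax; Σ-syntax; proj₁; proj₂)
open import Data.Sum using (_⊎_; inj₁; inj₂)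
open import Function using (id; _∘_)
open import Level using (0ℓ; _⊔_) renaming (suc to lsuc)
open import Relation.Binary.Definitions using (WeaklyDecidable)
open import Relation.Binary.PropositionalEquality as ≡ using (_≡_)
open import Relation.Nullary using (¬_; yes; no)

-- The coefficients of a Laurent series form a function on ℕ, so whether a series vanishes cannot be
-- decided. The linear algebra therefore branches only on scalars from 𝔽₂(ε): each comes with a
-- fraction, whose numerator is a finite list that can be inspected. Dependence is sought in the
-- form "some vector lies in the span of its predecessors" because that vector then has coefficient
-- 1, which stays 1 under squaring, so that passing to later powers of β needs no division.
--
-- In the ring of sequences the series S_j are their own partial sums, and the inverse of α is the
-- sequence of the reciprocal convergents, whose product with α tends to 1. For the descent the
-- equation for β is multiplied by α^(2^d). What remains is an identity in α with coefficients in
-- 𝔽₂(ε): a polynomial equation for α, and, once a β with α β = 1 is given, also the additive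
-- equation for that β.

CharacteristicTwo : ∀ {c ℓ} → CommutativeRing c ℓ → Set ℓ
CharacteristicTwo R = 1# + 1# ≈ 0#
  where open CommutativeRing R

-- Rings of characteristic two: sums, powers, subfields

module CharTwo {c ℓ} (R : CommutativeRing c ℓ) (1+1≈0 : CharacteristicTwo R) where
  open CommutativeRing R
  open import Relation.Binary.Reasoning.Setoid setoid

  private
    -- Coefficients for the ring solver. Normalising over 𝔽₂ makes it cancel `x + x`, so identities
    -- special to characteristic 2 are solved like any others.
    𝔽₂ : RawRing _ _
    𝔽₂ = record { Carrier = Bool ; _≈_ = _≡_ ; _+_ = _xor_ ; _*_ = _∧_ ; -_ = id ; 0# = false ; 1# = true }

    almostRing : AlmostCommutativeRing c ℓ
    almostRing = fromCommutativeSemiring commutativeSemiring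

    𝔽₂⟶R : 𝔽₂ -Raw-AlmostCommutative⟶ almostRing
    𝔽₂⟶R = record
      { ⟦_⟧    = λ b → if b then 1# else 0#
      ; +-homo = λ { false _ → sym (+-identityˡ _) ; true false → sym (+-identityʳ _) ; true true → sym 1+1≈0 }
      ; *-homo = λ { false _ → sym (zeroˡ _) ; true _ → sym (*-identityˡ _) }
      ; -‿homo = λ _ → refl
      ; 0-homo = refl
      ; 1-homo = refl
      }

    _coeff≟_ : WeaklyDecidable (λ x y → (if x then 1# else 0#) ≈ (if y then 1# else 0#))
    false coeff≟ false = just refl
    true  coeff≟ true  = just refl
    _     coeff≟ _     = nothing

  open RingSolver 𝔽₂ almostRing 𝔽₂⟶R _coeff≟_ public
    using (solve; _:=_; _:+_; _:*_; con)

  x+x≈0 : ∀ x → x + x ≈ 0#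
  x+x≈0 = solve 1 (λ x → x :+ x := con false) refl

  square-+ : ∀ x y → (x + y) * (x + y) ≈ x * x + y * y
  square-+ = solve 2 (λ x y → (x :+ y) :* (x :+ y) := x :* x :+ y :* y) refl

  x+y≈0⇒x≈y : ∀ {x y} → x + y ≈ 0# → x ≈ y
  x+y≈0⇒x≈y {x} {y} h = begin
    x              ≈⟨ solve 2 (λ x y → x := (x :+ y) :+ y) refl x y ⟩
    (x + y) + y    ≈⟨ +-congʳ h ⟩
    0# + y         ≈⟨ +-identityˡ y ⟩
    y              ∎

  x≈y⇒x+y≈0 : ∀ {x y} → x ≈ y → x + y ≈ 0#
  x≈y⇒x+y≈0 {x} {y} h = trans (+-congʳ h) (x+x≈0 y)

  inverse-unique : ∀ {x y z} → x * y ≈ 1# → x * z ≈ 1# → y ≈ z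
  inverse-unique {x} {y} {z} xy xz = begin
    y              ≈⟨ *-identityʳ y ⟨
    y * 1#         ≈⟨ *-congˡ xz ⟨
    y * (x * z)    ≈⟨ solve 3 (λ x y z → y :* (x :* z) := (x :* y) :* z) refl x y z ⟩
    (x * y) * z    ≈⟨ *-congʳ xy ⟩
    1# * z         ≈⟨ *-identityˡ z ⟩
    z              ∎

  sum : ℕ → (ℕ → Carrier) → Carrier
  sum zero    f = 0#
  sum (suc n) f = sum n f + f n

  sum-cong : ∀ n {f g} → (∀ i → i < n → f i ≈ g i) → sum n f ≈ sum n g
  sum-cong zero    h = refl
  sum-cong (suc n) h = +-cong (sum-cong n (λ i i<n → h i (ℕ.m<n⇒m<1+n i<n))) (h n (ℕ.n<1+n n))

  sum-+ : ∀ n f g → sum n (λ i → f i + g i) ≈ sum n f + sum n g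
  sum-+ zero    f g = sym (+-identityˡ 0#)
  sum-+ (suc n) f g = trans (+-congʳ (sum-+ n f g))
    (solve 4 (λ a b c d → (a :+ b) :+ (c :+ d) := (a :+ c) :+ (b :+ d)) refl _ _ _ _)

  sum-* : ∀ n a f → sum n (λ i → a * f i) ≈ a * sum n f
  sum-* zero    a f = sym (zeroʳ a)
  sum-* (suc n) a f = trans (+-congʳ (sum-* n a f)) (sym (distribˡ a _ _))

  sum-square : ∀ n f → sum n f * sum n f ≈ sum n (λ i → f i * f i)
  sum-square zero    f = zeroˡ 0#
  sum-square (suc n) f = trans (square-+ _ _) (+-congʳ (sum-square n f))

  sum-suc : ∀ n f → sum (suc n) f ≈ f 0 + sum n (f ∘ suc)
  sum-suc zero    f = +-comm 0# (f 0)
  sum-suc (suc n) f = trans (+-congʳ (sum-suc n f)) (+-assoc _ _ _)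

  sum-split : ∀ m n f → sum (m ℕ.+ n) f ≈ sum m f + sum n (λ i → f (m ℕ.+ i))
  sum-split m zero    f rewrite ℕ.+-identityʳ m = sym (+-identityʳ _)
  sum-split m (suc n) f rewrite ℕ.+-suc m n = trans (+-congʳ (sum-split m n f)) (+-assoc _ _ _)

  -- Summation by residue modulo `d`: every further block of `d` consecutive terms adds one term to
  -- each of the `d` inner sums.
  sum-blocks : ∀ k d f → sum (k ℕ.* d) f ≈ sum d (λ j → sum k (λ i → f (j ℕ.+ i ℕ.* d)))
  sum-blocks zero    d f = sym (sum-zero d)
    where
    sum-zero : ∀ n → sum n (λ _ → 0#) ≈ 0#
    sum-zero zero    = refl
    sum-zero (suc n) = trans (+-identityʳ _) (sum-zero n)
  sum-blocks (suc k) d f rewrite ℕ.+-comm d (k ℕ.* d) = trans (sum-split (k ℕ.* d) d f)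
    (trans (+-cong (sum-blocks k d f) (sum-cong d (λ j _ → reflexive (≡.cong f (ℕ.+-comm (k ℕ.* d) j)))))
    (sym (sum-+ d _ _)))

  infixr 8 _^_
  _^_ : Carrier → ℕ → Carrier
  x ^ zero  = 1#
  x ^ suc n = x ^ n * x

  ^-+ : ∀ x m n → x ^ (m ℕ.+ n) ≈ x ^ m * x ^ n
  ^-+ x m zero    rewrite ℕ.+-identityʳ m = sym (*-identityʳ _)
  ^-+ x m (suc n) rewrite ℕ.+-suc m n = trans (*-congʳ (^-+ x m n)) (*-assoc _ _ _)

  frob : ℕ → Carrier → Carrier
  frob zero    x = x
  frob (suc k) x = frob k x * frob k x

  ^2^k≈frob : ∀ k x → x ^ (2 ℕ.^ k) ≈ frob k x
  ^2^k≈frob zero    x = *-identityˡ x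
  ^2^k≈frob (suc k) x rewrite ℕ.+-identityʳ (2 ℕ.^ k) =
    trans (^-+ x (2 ℕ.^ k) (2 ℕ.^ k)) (*-cong (^2^k≈frob k x) (^2^k≈frob k x))

  frob-* : ∀ k x y → frob k (x * y) ≈ frob k x * frob k y
  frob-* zero    x y = refl
  frob-* (suc k) x y = trans (*-cong (frob-* k x y) (frob-* k x y))
    (solve 2 (λ a b → (a :* b) :* (a :* b) := (a :* a) :* (b :* b)) refl _ _)

  frob-1 : ∀ k {x} → x ≈ 1# → frob k x ≈ 1#
  frob-1 zero    h = h
  frob-1 (suc k) h = trans (*-cong (frob-1 k h) (frob-1 k h)) (*-identityˡ 1#)

  ^-∸ : ∀ {d k} x → k < d → x ^ (2 ℕ.^ d ℕ.∸ 2 ℕ.^ k) * frob k x ≈ frob d x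
  ^-∸ {d} {k} x k<d = begin
    x ^ (2 ℕ.^ d ℕ.∸ 2 ℕ.^ k) * frob k x         ≈⟨ *-congˡ (^2^k≈frob k x) ⟨
    x ^ (2 ℕ.^ d ℕ.∸ 2 ℕ.^ k) * x ^ (2 ℕ.^ k)    ≈⟨ ^-+ x (2 ℕ.^ d ℕ.∸ 2 ℕ.^ k) (2 ℕ.^ k) ⟨
    x ^ (2 ℕ.^ d ℕ.∸ 2 ℕ.^ k ℕ.+ 2 ℕ.^ k)
      ≈⟨ reflexive (≡.cong (x ^_) (ℕ.m∸n+n≡m (ℕ.^-monoʳ-≤ 2 (ℕ.<⇒≤ k<d)))) ⟩
    x ^ (2 ℕ.^ d)                                ≈⟨ ^2^k≈frob d x ⟩
    frob d x                                     ∎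

  module _ {x y} (xy≈1 : x * y ≈ 1#) (d : ℕ) (A : Carrier) (B : ℕ → Carrier) where
    private
      clear-denominators : ∀ k → k < d → frob d x * (B k * frob k y) ≈ B k * x ^ (2 ℕ.^ d ℕ.∸ 2 ℕ.^ k)
      clear-denominators k k<d = begin
        frob d x * (B k * frob k y)          ≈⟨ *-congʳ (^-∸ x k<d) ⟨
        (x ^ n * frob k x) * (B k * frob k y)
          ≈⟨ solve 4 (λ z a b c → (z :* a) :* (b :* c) := (b :* z) :* (a :* c)) refl _ _ _ _ ⟩
        (B k * x ^ n) * (frob k x * frob k y) ≈⟨ *-congˡ (trans (sym (frob-* k x y)) (frob-1 k xy≈1)) ⟩
        (B k * x ^ n) * 1#                    ≈⟨ *-identityʳ _ ⟩
        B k * x ^ n                           ∎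
        where n = 2 ℕ.^ d ℕ.∸ 2 ℕ.^ k

      frob-inverse : frob d x * frob d y ≈ 1#
      frob-inverse = trans (sym (frob-* d x y)) (frob-1 d xy≈1)

      expand : frob d x * (A + sum d (λ k → B k * frob k y)) ≈
        A * x ^ (2 ℕ.^ d) + sum d (λ k → B k * x ^ (2 ℕ.^ d ℕ.∸ 2 ℕ.^ k))
      expand = trans (distribˡ _ _ _) (+-cong (trans (*-comm _ A) (*-congˡ (sym (^2^k≈frob d x))))
        (trans (sym (sum-* d (frob d x) _)) (sum-cong d clear-denominators)))

    -- Multiplication by `x ^ (2 ^ d)` turns the power 2^k of `y` into `x ^ (2 ^ d ∸ 2 ^ k)`. The
    -- result no longer mentions `y`, so it can be pulled back to a ring that contains `x` only.
    reciprocal-equation : frob d y ≈ A + sum d (λ k → B k * frob k y) →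
      A * x ^ (2 ℕ.^ d) + sum d (λ k → B k * x ^ (2 ℕ.^ d ℕ.∸ 2 ℕ.^ k)) ≈ 1#
    reciprocal-equation h = trans (sym expand) (trans (*-congˡ (sym h)) frob-inverse)

    -- Both sides of the conclusion are inverses of `frob d x`, and inverses are unique.
    reciprocal-equation⁻¹ : A * x ^ (2 ℕ.^ d) + sum d (λ k → B k * x ^ (2 ℕ.^ d ℕ.∸ 2 ℕ.^ k)) ≈ 1# →
      frob d y ≈ A + sum d (λ k → B k * frob k y)
    reciprocal-equation⁻¹ h = inverse-unique frob-inverse (trans expand h)

  -- A field inside a ring that need not be one. `inv?` is the zero test on which elimination
  -- branches; it returns the inverse together with its membership.
  record IsSubfield {f} (F : Carrier → Set f) : Set (c ⊔ ℓ ⊔ f) where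
    field
      resp : ∀ {x y} → x ≈ y → F x → F y
      0∈   : F 0#
      1∈   : F 1#
      +∈   : ∀ {x y} → F x → F y → F (x + y)
      *∈   : ∀ {x y} → F x → F y → F (x * y)
      inv? : ∀ {x} → F x → x ≈ 0# ⊎ ∃[ y ] (F y × x * y ≈ 1#)

    inverse∈ : ∀ {x y} → F x → x * y ≈ 1# → F y
    inverse∈ {x} {y} x∈ xy≈1 with inv? x∈
    ... | inj₂ (z , z∈ , xz≈1) = resp (inverse-unique xz≈1 xy≈1) z∈
    -- The ring may be trivial, so this case is not absurd; it makes `y` zero.
    ... | inj₁ x≈0 = resp (sym y≈0) 0∈
      where
      y≈0 : y ≈ 0#
      y≈0 = begin
        y            ≈⟨ *-identityˡ y ⟨
        1# * y       ≈⟨ *-congʳ xy≈1 ⟨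
        (x * y) * y  ≈⟨ *-congʳ (trans (*-congʳ x≈0) (zeroˡ y)) ⟩
        0# * y       ≈⟨ zeroˡ y ⟩
        0#           ∎

    sum∈ : ∀ n {f} → (∀ i → F (f i)) → F (sum n f)
    sum∈ zero    h = 0∈
    sum∈ (suc n) h = +∈ (sum∈ n h) (h n)

  -- Linear algebra over a subfield with a zero test

  module Linear {f} {F : Carrier → Set f} (subfield : IsSubfield F) where
    open IsSubfield subfield

    -- Combinations of `g 0`, ..., `g (n - 1)` with coefficients in `F`, built from the left so that
    -- matching on `step` exposes the last coordinate, the one that elimination removes.
    data Span (g : ℕ → Carrier) : ℕ → Carrier → Set (c ⊔ ℓ ⊔ f) where
      empty : ∀ {y} → y ≈ 0# → Span g 0 y
      step  : ∀ {n y z a} → Span g n z → F a → y ≈ z + a * g n → Span g (suc n) y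

    span-resp : ∀ {g n y z} → y ≈ z → Span g n y → Span g n z
    span-resp y≈z (empty h)    = empty (trans (sym y≈z) h)
    span-resp y≈z (step s a h) = step s a (trans (sym y≈z) h)

    span-weaken : ∀ {g n y} → Span g n y → Span g (suc n) y
    span-weaken {g} {n} {y} s = step s 0∈ (solve 2 (λ y g → y := y :+ con false :* g) refl y (g n))

    span-0 : ∀ {g} n → Span g n 0#
    span-0 zero    = empty refl
    span-0 (suc n) = span-weaken (span-0 n)

    span-+ : ∀ {g n y z} → Span g n y → Span g n z → Span g n (y + z)
    span-+ (empty h) (empty h′) = empty (trans (+-cong h h′) (+-identityˡ 0#))
    span-+ (step s a h) (step s′ a′ h′) = step (span-+ s s′) (+∈ a a′) (trans (+-cong h h′)
      (solve 5 (λ x a y b g → (x :+ a :* g) :+ (y :+ b :* g) := (x :+ y) :+ (a :+ b) :* g) refl _ _ _ _ _))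

    span-* : ∀ {g n y b} → F b → Span g n y → Span g n (b * y)
    span-* b (empty h)    = empty (trans (*-congˡ h) (zeroʳ _))
    span-* b (step s a h) = step (span-* b s) (*∈ b a) (trans (*-congˡ h)
      (solve 4 (λ b x a g → b :* (x :+ a :* g) := b :* x :+ (b :* a) :* g) refl _ _ _ _))

    span-last : ∀ {g} n → Span g (suc n) (g n)
    span-last {g} n = step (span-0 n) 1∈ (solve 1 (λ g → g := con false :+ con true :* g) refl (g n))

    span-≤ : ∀ {g m n y} → m ≤ n → Span g m y → Span g n y
    span-≤ {m = m} {n} m≤n s with ℕ.m≤n⇒m<n∨m≡n m≤n
    span-≤ {n = suc n} _ s | inj₁ m<1+n = span-weaken (span-≤ (ℕ.s≤s⁻¹ m<1+n) s)
    span-≤ _ s | inj₂ ≡.refl = s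

    span-generator : ∀ {g n i} → i < n → Span g n (g i)
    span-generator {i = i} i<n = span-≤ i<n (span-last i)

    span-trans : ∀ {g h m n y} → (∀ i → i < n → Span h m (g i)) → Span g n y → Span h m y
    span-trans {m = m} g∈ (empty e) = span-resp (sym e) (span-0 m)
    span-trans {n = suc n} g∈ (step s a e) = span-resp (sym e)
      (span-+ (span-trans (λ i i<n → g∈ i (ℕ.m<n⇒m<1+n i<n)) s) (span-* a (g∈ n (ℕ.n<1+n n))))

    -- Squaring is additive in characteristic 2 and only squares the coefficients, so it is enough
    -- to control the squares of the generators.
    span-square : ∀ {g h m n y} → (∀ i → i < n → Span h m (g i * g i)) → Span g n y → Span h m (y * y)
    span-square {m = m} g∈ (empty e) = span-resp (sym (trans (*-cong e e) (zeroˡ 0#))) (span-0 m)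
    span-square {n = suc n} g∈ (step s a e) = span-resp (sym (trans (*-cong e e) (trans (square-+ _ _)
        (+-congˡ (solve 2 (λ a g → (a :* g) :* (a :* g) := (a :* a) :* (g :* g)) refl _ _)))))
      (span-+ (span-square (λ i i<n → g∈ i (ℕ.m<n⇒m<1+n i<n)) s) (span-* (*∈ a a) (g∈ n (ℕ.n<1+n n))))

    span-sum : ∀ {g n} m {y} → (∀ i → i < m → Span g n (y i)) → Span g n (sum m y)
    span-sum {n = n} zero    h = span-0 n
    span-sum (suc m) h = span-+ (span-sum m (λ i i<m → h i (ℕ.m<n⇒m<1+n i<m))) (h m (ℕ.n<1+n m))

    span-coefficients : ∀ {g n y} → Span g n y →
      Σ[ a ∈ (ℕ → Carrier) ] ((∀ i → F (a i)) × y ≈ sum n (λ i → a i * g i))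
    span-coefficients (empty h) = (λ _ → 0#) , (λ _ → 0∈) , h
    span-coefficients {g} {suc n} {y} (step {z = z} {a = b} s b∈ h) with span-coefficients s
    ... | a , a∈ , z≈ = a′ , a′∈ , trans h (+-cong (trans z≈ (sum-cong n below)) (*-congʳ (sym at)))
      where
      a′ : ℕ → Carrier
      a′ i with i <? n
      ... | yes _ = a i
      ... | no  _ = b
      a′∈ : ∀ i → F (a′ i)
      a′∈ i with i <? n
      ... | yes _ = a∈ i
      ... | no  _ = b∈
      below : ∀ i → i < n → a i * g i ≈ a′ i * g i
      below i i<n with i <? n
      ... | yes _   = refl
      ... | no  i≮n = ⊥-elim (i≮n i<n)
      at : a′ n ≈ b
      at with n <? n
      ... | yes n<n = ⊥-elim (ℕ.<-irrefl ≡.refl n<n)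
      ... | no  _   = refl

    private
      -- The first vector with a non-zero last coordinate determines the last generator modulo the others.
      pivot : ∀ {g m} (x : ℕ → Carrier) → (∀ i → Span g (suc m) (x i)) → ∀ n →
        (∀ i → i < n → Span g m (x i)) ⊎
        ∃[ p ] (p < n × (∀ i → i < p → Span g m (x i)) × ∃[ b ] (F b × Span g m (g m + b * x p)))
      pivot x x∈ zero = inj₁ (λ _ ())
      pivot {g} {m} x x∈ (suc n) with pivot x x∈ n
      ... | inj₂ (p , p<n , below , b) = inj₂ (p , ℕ.m<n⇒m<1+n p<n , below , b)
      ... | inj₁ below with x∈ n
      ... | step {z = z} {a = a} s a∈ h with inv? a∈
      ... | inj₁ a≈0 = inj₁ below′
        where
        below′ : ∀ i → i < suc n → Span g m (x i)
        below′ i i<1+n with ℕ.m<1+n⇒m<n∨m≡n i<1+n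
        ... | inj₁ i<n = below i i<n
        ... | inj₂ ≡.refl = span-resp (sym (trans h (trans (+-congˡ
          (trans (*-congʳ a≈0) (zeroˡ _))) (+-identityʳ z)))) s
      ... | inj₂ (b , b∈ , ab≈1) = inj₂ (n , ℕ.n<1+n n , below , b , b∈ , span-resp eq (span-* b∈ s))
        where
        eq : b * z ≈ g m + b * x n
        eq = sym (begin
          g m + b * x n                ≈⟨ +-congˡ (*-congˡ h) ⟩
          g m + b * (z + a * g m)
            ≈⟨ solve 4 (λ g b z a → g :+ b :* (z :+ a :* g) := b :* z :+ (con true :+ a :* b) :* g) refl _ _ _ _ ⟩
          b * z + (1# + a * b) * g m   ≈⟨ +-congˡ (*-congʳ (x≈y⇒x+y≈0 (sym ab≈1))) ⟩
          b * z + 0# * g m             ≈⟨ solve 2 (λ z g → z :+ con false :* g := z) refl _ _ ⟩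
          b * z                        ∎)

    abstract
      -- Gaussian elimination, by induction on the number of generators. A pivot among the first
      -- `suc m` vectors clears the last coordinate of the later ones and is then dropped; the rest
      -- lies in the span of one generator fewer.
      dependent : ∀ m {g} (x : ℕ → Carrier) → (∀ i → Span g m (x i)) → ∃[ k ] (k ≤ m × Span x k (x k))
      dependent zero x x∈ with x∈ 0
      ... | empty h = 0 , z≤n , empty h
      dependent (suc m) {g} x x∈ with pivot x x∈ (suc m)
      ... | inj₁ below = lift (dependent m y y∈)
        where
        y : ℕ → Carrier
        y i with i <? suc m
        ... | yes _ = x i
        -- Only the first `suc m` vectors are known to lie in the smaller span. The index found is
        -- at most `m`, so it never reaches this padding.
        ... | no  _ = 0#
        y∈ : ∀ i → Span g m (y i)
        y∈ i with i <? suc m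
        ... | yes i≤m = below i i≤m
        ... | no  _   = span-0 m
        y≈x : ∀ i → i < suc m → y i ≈ x i
        y≈x i i≤m with i <? suc m
        ... | yes _   = refl
        ... | no  i≰m = ⊥-elim (i≰m i≤m)
        lift : ∃[ k ] (k ≤ m × Span y k (y k)) → ∃[ k ] (k ≤ suc m × Span x k (x k))
        lift (k , k≤m , s) = k , ℕ.m≤n⇒m≤1+n k≤m , span-resp (y≈x k (s≤s k≤m))
          (span-trans (λ i i<k → span-resp (sym (y≈x i (ℕ.<-trans i<k (s≤s k≤m)))) (span-generator i<k)) s)
      ... | inj₂ (p , p≤m , below , b , b∈ , gₘ∈) = lift (dependent m y y∈)
        where
        eliminate : ∀ i → ∃[ e ] (F e × Span g m (x i + e * x p))
        eliminate i with x∈ i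
        -- As `g m + b * x p` lies in the smaller span, adding `a * b` times the pivot cancels the
        -- last coordinate `a`.
        ... | step {z = z} {a = a} s a∈ h = a * b , *∈ a∈ b∈ , span-resp (sym (trans (+-congʳ h)
            (solve 5 (λ z a g b x → (z :+ a :* g) :+ (a :* b) :* x := z :+ a :* (g :+ b :* x)) refl _ _ _ _ _)))
          (span-+ s (span-* a∈ gₘ∈))
        y : ℕ → Carrier
        y i with i <? p
        ... | yes _ = x i
        -- Dropping the pivot moves later vectors down by one: an index `k ≥ p` for `y` means
        -- `suc k` for `x`.
        ... | no  _ = x (suc i) + proj₁ (eliminate (suc i)) * x p
        y∈ : ∀ i → Span g m (y i)
        y∈ i with i <? p
        ... | yes i<p = below i i<p
        ... | no  _   = proj₂ (proj₂ (eliminate (suc i)))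
        y∈x : ∀ i → Span x (suc (suc i)) (y i)
        y∈x i with i <? p
        ... | yes _   = span-generator (s≤s (ℕ.n≤1+n i))
        ... | no  i≮p = span-+ (span-last (suc i)) (span-* (proj₁ (proj₂ (eliminate (suc i))))
          (span-generator (s≤s (ℕ.m≤n⇒m≤1+n (ℕ.≮⇒≥ i≮p)))))
        lift : ∃[ k ] (k ≤ m × Span y k (y k)) → ∃[ k ] (k ≤ suc m × Span x k (x k))
        lift (k , k≤m , s) with k <? p
        ... | yes k<p = k , ℕ.m≤n⇒m≤1+n k≤m , span-trans early s
          where
          early : ∀ i → i < k → Span x k (y i)
          early i i<k with i <? p
          ... | yes _   = span-generator i<k
          ... | no  i≮p = ⊥-elim (i≮p (ℕ.<-trans i<k k<p))
        ... | no  k≮p = suc k , s≤s k≤m , span-resp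
            (solve 3 (λ x e p → (x :+ e :* p) :+ e :* p := x) refl _ _ _)
            (span-+ (span-trans early s) (span-* (proj₁ (proj₂ (eliminate (suc k))))
              (span-generator (s≤s (ℕ.≮⇒≥ k≮p)))))
          where
          early : ∀ i → i < k → Span x (suc k) (y i)
          early i i<k = span-≤ (s≤s i<k) (y∈x i)

    powers : Carrier → ℕ → Carrier
    powers β zero    = 1#
    powers β (suc k) = frob k β

    abstract
      -- Once some power lies in the span of the earlier ones, squaring propagates this to all later ones.
      dependent-frob : ∀ m {g β} → (∀ i → i < suc m → Span g (suc m) (g i * g i)) →
        Span g (suc m) 1# → Span g (suc m) β → Span (powers β) (suc m) (frob m β)
      dependent-frob m {g} {β} g²∈ 1∈ β∈ with dependent (suc m) (powers β) powers∈
        where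
        powers∈ : ∀ i → Span g (suc m) (powers β i)
        powers∈ zero          = 1∈
        powers∈ (suc zero)    = β∈
        powers∈ (suc (suc i)) = span-square g²∈ (powers∈ (suc i))
      ... | k , k≤1+m , s = ascend k≤1+m s
        where
        next : ∀ k → Span (powers β) k (powers β k) → Span (powers β) (suc k) (powers β (suc k))
        -- Dependence of the very first vector means `1# ≈ 0#`, and then `β` is zero.
        next zero    (empty 1≈0) = span-resp (trans (sym (zeroʳ β)) (trans (*-congˡ
          (sym 1≈0)) (*-identityʳ β))) (span-0 1)
        next (suc k) s = span-square squares s
          where
          squares : ∀ i → i < suc k → Span (powers β) (suc (suc k)) (powers β i * powers β i)
          squares zero    _ = span-resp (sym (*-identityˡ 1#)) (span-generator (s≤s z≤n))
          squares (suc i) i<k = span-generator (s≤s i<k)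
        ascend : ∀ {k n} → k ≤ n → Span (powers β) k (powers β k) → Span (powers β) n (powers β n)
        ascend {k} {n} k≤n s with ℕ.m≤n⇒m<n∨m≡n k≤n
        ascend {n = suc n} _ s | inj₁ k<1+n = next n (ascend (ℕ.s≤s⁻¹ k<1+n) s)
        ascend _ s | inj₂ ≡.refl = s

    abstract
      additive-equation : ∀ d {S e : ℕ → Carrier} {r u} →
        (∀ j → F (e j)) → F r → F u →
        (∀ j → j < d → S j * S j ≈ e j * S (suc j)) → S d ≈ S 0 + u → 0 < d →
        let β = r + sum d S in
        Σ[ A ∈ Carrier ] Σ[ B ∈ (ℕ → Carrier) ]
          (F A × (∀ k → F (B k)) × frob d β ≈ A + sum d (λ k → B k * frob k β))
      additive-equation d {S} {e} {r} {u} e∈ r∈ u∈ S² Sd 0<d =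
        constant-term (span-coefficients (dependent-frob d {g} squares (const∈ 1∈) β∈))
        where
        g : ℕ → Carrier
        g zero    = 1#
        g (suc j) = S j
        const∈ : ∀ {x} → F x → Span g (suc d) x
        const∈ x∈ = span-resp (*-identityʳ _) (span-* x∈ (span-generator {i = 0} (s≤s z≤n)))
        S∈ : ∀ j → j ≤ d → Span g (suc d) (S j)
        S∈ j j≤d with ℕ.m≤n⇒m<n∨m≡n j≤d
        ... | inj₁ j<d    = span-generator (s≤s j<d)
        -- The cycle closes: `S d` is no generator, but `S 0` is one because `0 < d`, and the
        -- generator `1#` absorbs `u`.
        ... | inj₂ ≡.refl = span-resp (sym Sd) (span-+ (span-generator (s≤s 0<d)) (const∈ u∈))
        squares : ∀ i → i < suc d → Span g (suc d) (g i * g i)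
        squares zero    _         = span-resp (sym (*-identityˡ 1#)) (const∈ 1∈)
        squares (suc j) (s≤s j<d) = span-resp (sym (S² j j<d)) (span-* (e∈ j) (S∈ (suc j) j<d))
        β∈ : Span g (suc d) (r + sum d S)
        β∈ = span-+ (const∈ r∈) (span-sum d (λ i i<d → S∈ i (ℕ.<⇒≤ i<d)))
        constant-term : ∀ {y} →
          Σ[ a ∈ (ℕ → Carrier) ] ((∀ i → F (a i)) × y ≈ sum (suc d) (λ i → a i * powers (r + sum d S) i)) →
          Σ[ A ∈ Carrier ] Σ[ B ∈ (ℕ → Carrier) ]
            (F A × (∀ k → F (B k)) × y ≈ A + sum d (λ k → B k * frob k (r + sum d S)))
        constant-term (a , a∈ , eq) = a 0 , a ∘ suc , a∈ 0 , a∈ ∘ suc ,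
          trans eq (trans (sum-suc d _) (+-congʳ (*-identityʳ (a 0))))

    Vanishing : Carrier → ℕ → (ℕ → Carrier) → Set (ℓ ⊔ f)
    Vanishing α n P = (∀ i → F (P i)) × sum (suc n) (λ i → P i * α ^ i) ≈ 0#

    -- Writing 1 by positive powers of `α` gives a polynomial with constant term 1, the invertible
    -- coefficient from which `raise-degree` starts.
    vanishing-polynomial : ∀ {n α} → Span (λ i → α ^ suc i) n 1# → ∃[ P ] (Vanishing α n P × P 0 ≈ 1#)
    vanishing-polynomial {n} {α} s with span-coefficients s
    ... | a , a∈ , eq = P , (P∈ , trans (sum-suc n (λ i → P i * α ^ i)) (x≈y⇒x+y≈0
      (trans (*-identityˡ 1#) eq))) , refl
      where
      P : ℕ → Carrier
      P zero    = 1#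
      P (suc i) = a i
      P∈ : ∀ i → F (P i)
      P∈ zero    = 1∈
      P∈ (suc i) = a∈ i

    -- Multiplying by x raises the degree until the top coefficient is non-zero.
    raise-degree : ∀ k {j n α P} → k ℕ.+ j ≡ n → Vanishing α n P → ∃[ y ] P j * y ≈ 1# →
      ∃[ Q ] (Vanishing α n Q × ∃[ y ] Q n * y ≈ 1#)
    raise-degree zero {P = P} ≡.refl vanishing nonzero = P , vanishing , nonzero
    raise-degree (suc k) {j} {n} {α} {P} k+j≡n (P∈ , root) nonzero with inv? (P∈ n)
    ... | inj₂ (y , _ , Pₙy≈1) = P , (P∈ , root) , y , Pₙy≈1
    -- With a vanishing top coefficient there is room for a shift, which moves the invertible
    -- coefficient from `j` to `suc j` and shrinks the gap `k` to the top.
    ... | inj₁ Pₙ≈0 = raise-degree k (≡.trans (ℕ.+-suc k j) k+j≡n) (Q∈ , root′) nonzero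
      where
      Q : ℕ → Carrier
      Q zero    = 0#
      Q (suc i) = P i
      Q∈ : ∀ i → F (Q i)
      Q∈ zero    = 0∈
      Q∈ (suc i) = P∈ i
      root′ : sum (suc n) (λ i → Q i * α ^ i) ≈ 0#
      root′ = begin
        sum (suc n) (λ i → Q i * α ^ i)           ≈⟨ sum-suc n (λ i → Q i * α ^ i) ⟩
        0# * 1# + sum n (λ i → P i * (α ^ i * α))
          ≈⟨ +-cong (zeroˡ 1#) (sum-cong n (λ i _ → solve 3 (λ p x a →
          p :* (x :* a) := a :* (p :* x)) refl _ _ _)) ⟩
        0# + sum n (λ i → α * (P i * α ^ i))      ≈⟨ trans (+-identityˡ _) (sum-* n α _) ⟩
        α * sum n (λ i → P i * α ^ i)
          ≈⟨ *-congˡ (trans (sym (+-identityʳ _)) (+-congˡ (sym (trans (*-congʳ Pₙ≈0) (zeroˡ _))))) ⟩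
        α * sum (suc n) (λ i → P i * α ^ i)       ≈⟨ *-congˡ root ⟩
        α * 0#                                    ≈⟨ zeroʳ α ⟩
        0#                                        ∎

    abstract
      -- For `k < d` all exponents lie between 1 and 2^d, so the equation expresses 1 by positive
      -- powers of `α`. Since `A` may be zero, the exact degree has to be enforced afterwards.
      reciprocal-polynomial : ∀ d {α A} {B : ℕ → Carrier} → F A → (∀ k → F (B k)) →
        A * α ^ (2 ℕ.^ d) + sum d (λ k → B k * α ^ (2 ℕ.^ d ℕ.∸ 2 ℕ.^ k)) ≈ 1# →
        ∃[ P ] (Vanishing α (2 ℕ.^ d) P × ∃[ y ] P (2 ℕ.^ d) * y ≈ 1#)
      reciprocal-polynomial d {α} {A} {B} A∈ B∈ eq = raise (vanishing-polynomial (span-resp eq span))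
        where
        power : ∀ {m n} → 0 < m → m ≤ n → Span (λ i → α ^ suc i) n (α ^ m)
        power {suc m} _ m<n = span-generator m<n
        span : Span (λ i → α ^ suc i) (2 ℕ.^ d) (A * α ^ (2 ℕ.^ d) + sum d (λ k → B k * α ^ (2 ℕ.^ d ℕ.∸ 2 ℕ.^ k)))
        span = span-+ (span-* A∈ (power (ℕ.m^n>0 2 d) ℕ.≤-refl)) (span-sum d λ k k<d →
          span-* (B∈ k) (power (ℕ.m<n⇒0<n∸m (ℕ.^-monoʳ-< 2 ℕ.≤-refl k<d)) (ℕ.m∸n≤m (2 ℕ.^ d) (2 ℕ.^ k))))
        raise : ∃[ P ] (Vanishing α (2 ℕ.^ d) P × P 0 ≈ 1#) →
          ∃[ P ] (Vanishing α (2 ℕ.^ d) P × ∃[ y ] P (2 ℕ.^ d) * y ≈ 1#)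
        raise (P , vanishing , P₀≈1) = raise-degree (2 ℕ.^ d) (ℕ.+-identityʳ _) vanishing
          (1# , trans (*-identityʳ _) P₀≈1)

-- Descent along an injective ring homomorphism

module Extension {k ℓ₁ s ℓ₂} (K : CommutativeRing k ℓ₁) (S : CommutativeRing s ℓ₂)
  (K₂ : CharacteristicTwo K) (S₂ : CharacteristicTwo S)
  {ι : CommutativeRing.Carrier K → CommutativeRing.Carrier S}
  (mono : IsRingMonomorphism (CommutativeRing.rawRing K) (CommutativeRing.rawRing S) ι) where
  private
    module K where
      open CommutativeRing K public
      open CharTwo K K₂ public
    module S where
      open CommutativeRing S public
      open CharTwo S S₂ public
  open S using (_≈_; _+_; _*_; 0#; 1#)
  open IsRingMonomorphism mono

  sum-homo : ∀ n {f : ℕ → K.Carrier} {g} → (∀ i → ι (f i) ≈ g i) → ι (K.sum n f) ≈ S.sum n g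
  sum-homo zero    h = 0#-homo
  sum-homo (suc n) h = S.trans (+-homo _ _) (S.+-cong (sum-homo n h) (h n))

  ^-homo : ∀ x n → ι (x K.^ n) ≈ ι x S.^ n
  ^-homo x zero    = 1#-homo
  ^-homo x (suc n) = S.trans (*-homo _ _) (S.*-congʳ (^-homo x n))

  module _ {f} {F : K.Carrier → Set f} (subfield : K.IsSubfield F) where
    private
      module F = K.IsSubfield subfield

      Image : S.Carrier → Set _
      Image x = ∃[ y ] (F y × x ≈ ι y)

      image-inverse : ∀ {x z} → z ≈ ι x → x K.≈ K.0# ⊎ ∃[ y ] (F y × x K.* y K.≈ K.1#) →
        z ≈ 0# ⊎ ∃[ y ] (Image y × z * y ≈ 1#)
      image-inverse h (inj₁ x≈0)           = inj₁ (S.trans h (S.trans (⟦⟧-cong x≈0) 0#-homo))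
      image-inverse h (inj₂ (y , y∈ , xy)) = inj₂ (ι y , (y , y∈ , S.refl) ,
        S.trans (S.*-congʳ h) (S.trans (S.sym (*-homo _ _)) (S.trans (⟦⟧-cong xy) 1#-homo)))

      image-subfield : S.IsSubfield Image
      image-subfield = record
        { resp = λ { x≈y (z , z∈ , h) → z , z∈ , S.trans (S.sym x≈y) h }
        ; 0∈   = K.0# , F.0∈ , S.sym 0#-homo
        ; 1∈   = K.1# , F.1∈ , S.sym 1#-homo
        ; +∈   = λ { (x , x∈ , h) (y , y∈ , k) → x K.+ y , F.+∈ x∈ y∈ ,
          S.trans (S.+-cong h k) (S.sym (+-homo _ _)) }
        ; *∈   = λ { (x , x∈ , h) (y , y∈ , k) → x K.* y , F.*∈ x∈ y∈ ,
          S.trans (S.*-cong h k) (S.sym (*-homo _ _)) }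
        ; inv? = λ { (x , x∈ , h) → image-inverse h (F.inv? x∈) }
        }

      image : ∀ {x} → F x → Image (ι x)
      image x∈ = _ , x∈ , S.refl

    abstract
      -- The series `X` and the reciprocal of `α` live in `S` only. After clearing denominators
      -- every term is the image of an element of `K`, and injectivity of `ι` applies.
      reciprocal-algebraic : ∀ d {α r u} {e : ℕ → K.Carrier} {X : ℕ → S.Carrier} →
        (∀ j → F (e j)) → F r → F u →
        (∀ j → j < d → X j * X j ≈ ι (e j) * X (suc j)) → X d ≈ X 0 + ι u → 0 < d →
        ι α * (ι r + S.sum d X) ≈ 1# →
        Σ[ A ∈ K.Carrier ] Σ[ B ∈ (ℕ → K.Carrier) ] (F A × (∀ k → F (B k)) ×
          A K.* α K.^ (2 ℕ.^ d) K.+ K.sum d (λ k → B k K.* α K.^ (2 ℕ.^ d ℕ.∸ 2 ℕ.^ k)) K.≈ K.1#)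
      reciprocal-algebraic d {α} e∈ r∈ u∈ X² Xd 0<d αβ≈1
        with S.Linear.additive-equation image-subfield d (λ j → image (e∈ j)) (image r∈) (image u∈) X² Xd 0<d
      ... | A , B , (a , a∈ , A≈a) , B∈ , eq = a , b , a∈ , (λ k → proj₁ (proj₂ (B∈ k))) , injective
          (S.trans (+-homo _ _) (S.trans (S.+-cong (monomial (2 ℕ.^ d) A≈a) (sum-homo d λ k →
            monomial (2 ℕ.^ d ℕ.∸ 2 ℕ.^ k) (proj₂ (proj₂ (B∈ k)))))
          (S.trans (S.reciprocal-equation αβ≈1 d A B eq) (S.sym 1#-homo))))
        where
        b : ℕ → K.Carrier
        b k = proj₁ (B∈ k)
        monomial : ∀ n {x y} → y ≈ ι x → ι (x K.* α K.^ n) ≈ y * ι α S.^ n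
        monomial n h = S.trans (*-homo _ _) (S.*-cong (S.sym h) (^-homo α n))

-- Filtered rings and bounded sequences modulo null sequences

-- Ord m models the ideal t^(-m) 𝔽₂[[1/t]] of the valuation ring 𝔽₂[[1/t]].
record Filtration {c ℓ} (K : CommutativeRing c ℓ) o : Set (c ⊔ ℓ ⊔ lsuc o) where
  open CommutativeRing K
  field
    Ord       : ℕ → Carrier → Set o
    resp      : ∀ {m x y} → x ≈ y → Ord m x → Ord m y
    0∈        : ∀ {m} → Ord m 0#
    1∈        : Ord 0 1#
    +∈        : ∀ {m x y} → Ord m x → Ord m y → Ord m (x + y)
    *∈        : ∀ {m n x y} → Ord m x → Ord n y → Ord (m ℕ.+ n) (x * y)
    weaken    : ∀ m {n x} → Ord (m ℕ.+ n) x → Ord m x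
    bounded   : ∀ x → ∃[ N ] (∀ {m y} → Ord (N ℕ.+ m) y → Ord m (x * y))
    separated : ∀ {x} → (∀ m → Ord m x) → x ≈ 0#
    unit      : ∀ {x} → Ord 1 x → ∃[ y ] (1# + x) * y ≈ 1#

  weaken-≤ : ∀ {m n x} → m ≤ n → Ord n x → Ord m x
  weaken-≤ {m} {n} {x} m≤n h = weaken m (≡.subst (λ k → Ord k x) (≡.sym (ℕ.m+[n∸m]≡n m≤n)) h)

-- An extension of K in which series can be summed without completing K.
module BoundedSequences {c ℓ o} (K : CommutativeRing c ℓ) (1+1≈0 : CharacteristicTwo K) (filtration : Filtration K o) where
  open CommutativeRing K
  open CharTwo K 1+1≈0
  open Filtration filtration

  Null : (ℕ → Carrier) → Set o
  Null x = ∀ m → ∃[ N ] (∀ n → N ≤ n → Ord m (x n))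

  -- `Ord` has natural indices and cannot express poles, so boundedness is phrased by
  -- multiplication: every entry costs at most `N` of the order.
  Bounded : (ℕ → Carrier) → Set (c ⊔ o)
  Bounded x = ∃[ N ] (∀ n {m y} → Ord (N ℕ.+ m) y → Ord m (x n * y))

  null-resp : ∀ {x y} → (∀ n → x n ≈ y n) → Null x → Null y
  null-resp h x→0 m with x→0 m
  ... | N , small = N , λ n N≤n → resp (h n) (small n N≤n)

  null-+ : ∀ {x y} → Null x → Null y → Null (λ n → x n + y n)
  null-+ x→0 y→0 m with x→0 m | y→0 m
  ... | M , small | N , small′ = M ℕ.⊔ N , λ n h →
    +∈ (small n (ℕ.m⊔n≤o⇒m≤o M N h)) (small′ n (ℕ.m⊔n≤o⇒n≤o M N h))

  null-* : ∀ {x y} → Bounded x → Null y → Null (λ n → x n * y n)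
  null-* (B , bound) y→0 m with y→0 (B ℕ.+ m)
  ... | N , small = N , λ n N≤n → bound n (small n N≤n)

  null-subsequence : ∀ {x} (s : ℕ → ℕ) → (∀ k → k ≤ s k) → Null x → Null (x ∘ s)
  null-subsequence s k≤s x→0 m with x→0 m
  ... | N , small = N , λ n N≤n → small (s n) (ℕ.≤-trans N≤n (k≤s n))

  record Sequence : Set (c ⊔ o) where
    no-eta-equality
    constructor sequence
    field
      at : ℕ → Carrier
      at-bounded : Bounded at
  open Sequence public

  infix 4 _∼_
  record _∼_ (x y : Sequence) : Set o where
    constructor null
    field difference : Null (λ n → at x n + at y n)
  open _∼_ public

  pointwise : ∀ {x y} → (∀ n → at x n ≈ at y n) → x ∼ y
  pointwise h = null λ m → 0 , λ n _ → resp (sym (x≈y⇒x+y≈0 (h n))) 0∈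

  ∼-sym : ∀ {x y} → x ∼ y → y ∼ x
  ∼-sym (null h) = null (null-resp (λ n → +-comm _ _) h)

  ∼-trans : ∀ {x y z} → x ∼ y → y ∼ z → x ∼ z
  ∼-trans (null h) (null k) = null (null-resp
    (λ n → solve 3 (λ x y z → (x :+ y) :+ (y :+ z) := x :+ z) refl _ _ _) (null-+ h k))

  integral : (x : ℕ → Carrier) → (∀ n → Ord 0 (x n)) → Sequence
  integral x h = sequence x (0 , λ n → *∈ (h n))

  const : Carrier → Sequence
  const x = sequence (λ _ → x) (proj₁ (bounded x) , λ _ → proj₂ (bounded x))

  -- A constant null sequence has its value in every `Ord m`, hence the value is zero by
  -- `separated`.
  const-injective : ∀ {x y} → const x ∼ const y → x ≈ y
  const-injective (null h) = x+y≈0⇒x≈y (separated λ m → proj₂ (h m) _ ℕ.≤-refl)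

  infixl 6 _+S_
  _+S_ : Sequence → Sequence → Sequence
  x +S y = sequence (λ n → at x n + at y n) (M ℕ.+ N , bound)
    where
    M = proj₁ (at-bounded x)
    N = proj₁ (at-bounded y)
    bound : ∀ n {m z} → Ord (M ℕ.+ N ℕ.+ m) z → Ord m ((at x n + at y n) * z)
    bound n {m} {z} h = resp (sym (distribʳ z (at x n) (at y n))) (+∈
      (proj₂ (at-bounded x) n (weaken-≤ (ℕ.+-monoˡ-≤ m (ℕ.m≤m+n M N)) h))
      (proj₂ (at-bounded y) n (weaken-≤ (ℕ.+-monoˡ-≤ m (ℕ.m≤n+m N M)) h)))

  infixl 7 _*S_
  _*S_ : Sequence → Sequence → Sequence
  x *S y = sequence (λ n → at x n * at y n) (N ℕ.+ M , bound)
    where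
    M = proj₁ (at-bounded x)
    N = proj₁ (at-bounded y)
    bound : ∀ n {m z} → Ord (N ℕ.+ M ℕ.+ m) z → Ord m ((at x n * at y n) * z)
    bound n {m} {z} h = resp (sym (*-assoc _ _ _))
      (proj₂ (at-bounded x) n (proj₂ (at-bounded y) n (≡.subst (λ k → Ord k z) (ℕ.+-assoc N M m) h)))

  sequenceRing : CommutativeRing (c ⊔ o) o
  sequenceRing = record
    { Carrier = Sequence ; _≈_ = _∼_ ; _+_ = _+S_ ; _*_ = _*S_ ; -_ = id ; 0# = const 0# ; 1# = const 1#
    ; isCommutativeRing = record
      { isRing = record
        { +-isAbelianGroup = record
          { isGroup = record
            { isMonoid = record
              { isSemigroup = record
                { isMagma = record
                  { isEquivalence = record { refl = pointwise (λ _ → refl) ; sym = ∼-sym ; trans = ∼-trans }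
                  ; ∙-cong = λ { (null h) (null k) → null (null-resp (λ n →
                      solve 4 (λ x y u v → (x :+ y) :+ (u :+ v) := (x :+ u) :+ (y :+ v))
                        refl _ _ _ _) (null-+ h k)) } }
                ; assoc = λ _ _ _ → pointwise (λ _ → +-assoc _ _ _) }
              ; identity = (λ _ → pointwise (λ _ → +-identityˡ _)) , (λ _ → pointwise (λ _ → +-identityʳ _)) }
            ; inverse = (λ x → pointwise (λ n → x+x≈0 (at x n))) , (λ x → pointwise (λ n → x+x≈0 (at x n)))
            ; ⁻¹-cong = id }
          ; comm = λ _ _ → pointwise (λ _ → +-comm _ _) }
        -- The difference of the products is split so that each null factor meets a bounded one.
        ; *-cong = λ { {x} {y} {u} {v} (null h) (null k) → null (null-resp (λ n →
            solve 4 (λ x y u v → x :* (u :+ v) :+ v :* (x :+ y) := x :* u :+ y :* v) refl _ _ _ _)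
            (null-+ (null-* (at-bounded x) k) (null-* (at-bounded v) h))) }
        ; *-assoc = λ _ _ _ → pointwise (λ _ → *-assoc _ _ _)
        ; *-identity = (λ _ → pointwise (λ _ → *-identityˡ _)) , (λ _ → pointwise (λ _ → *-identityʳ _))
        ; distrib = (λ _ _ _ → pointwise (λ _ → distribˡ _ _ _)) , (λ _ _ _ → pointwise (λ _ → distribʳ _ _ _))
        }
      ; *-comm = λ _ _ → pointwise (λ _ → *-comm _ _)
      }
    }

  sequence-char2 : CharacteristicTwo sequenceRing
  sequence-char2 = pointwise (λ _ → 1+1≈0)

  const-monomorphism : IsRingMonomorphism rawRing (CommutativeRing.rawRing sequenceRing) const
  const-monomorphism = record
    { isRingHomomorphism = record
      { isSemiringHomomorphism = record
        { isNearSemiringHomomorphism = record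
          { +-isMonoidHomomorphism = record
            { isMagmaHomomorphism = record
              { isRelHomomorphism = record { cong = λ h → pointwise (λ _ → h) }
              ; homo = λ _ _ → pointwise (λ _ → refl) }
            ; ε-homo = pointwise (λ _ → refl) }
          ; *-homo = λ _ _ → pointwise (λ _ → refl) }
        ; 1#-homo = pointwise (λ _ → refl) }
      ; -‿homo = λ x → pointwise (λ _ → x+y≈0⇒x≈y (-‿inverseˡ x)) }
    ; injective = const-injective }

  open CharTwo sequenceRing sequence-char2 using () renaming (sum to sumS)
  open Extension K sequenceRing 1+1≈0 sequence-char2 const-monomorphism using (reciprocal-algebraic)

  at-sum : ∀ n {f g k} → (∀ i → at (f i) k ≈ g i) → at (sumS n f) k ≈ sum n g
  at-sum zero    h = refl
  at-sum (suc n) h = +-cong (at-sum n h) (h n)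

  -- The series of reciprocal numerators, split by residue

  module Continued (e e⁻¹ : ℕ → Carrier) (inverse : ∀ n → e n * e⁻¹ n ≈ 1#) (small : ∀ n → Ord 1 (e⁻¹ n)) where

    -- u n = 1 / p_n for the numerator p_n of the convergent with partial quotients W_n,
    -- and β n is the reciprocal of that convergent.
    u : ℕ → Carrier
    u zero    = 1#
    u (suc n) = e⁻¹ n * (u n * u n)

    β : ℕ → Carrier
    β n = sum n (u ∘ suc)

    ord-u : ∀ n → Ord n (u n)
    ord-u zero    = 1∈
    -- The product has order `1 + (n + n)`; gaining one per step already gives convergence.
    ord-u (suc n) = weaken (suc n) (*∈ (small n) (*∈ (ord-u n) (ord-u n)))

    ord-sum : ∀ n {x} → (∀ i → Ord 0 (x i)) → Ord 0 (sum n x)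
    ord-sum zero    h = 0∈
    ord-sum (suc n) h = +∈ (ord-sum n h) (h n)

    u-integral : ∀ n → Ord 0 (u n)
    u-integral n = weaken-≤ z≤n (ord-u n)

    u-null : Null u
    u-null m = m , λ n m≤n → weaken-≤ m≤n (ord-u n)

    u-square : ∀ n → u n * u n ≈ e n * u (suc n)
    u-square n = sym (trans (sym (*-assoc _ _ _)) (trans (*-congʳ (inverse n)) (*-identityˡ _)))

    module Periodic {l d} (0<d : 0 < d) (periodic : ∀ n → l ≤ n → e (n ℕ.+ d) ≈ e n) where

      -- The index starts at `l + 1` because `β l` takes the terms before it. From there on `e` is
      -- periodic, so squaring the terms of one class produces the common factor `e (suc (l + j))`.
      term : ℕ → ℕ → Carrier
      term j i = u (suc (l ℕ.+ (j ℕ.+ i ℕ.* d)))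

      k≤l+k*d : ∀ k → k ≤ l ℕ.+ k ℕ.* d
      k≤l+k*d k = ℕ.≤-trans (ℕ.m≤m*n k d {{ℕ.>-nonZero 0<d}}) (ℕ.m≤n+m _ l)

      -- The series S_j as an element of `sequenceRing`: integrality of the partial sums makes the
      -- sequence bounded.
      partialSums : ℕ → Sequence
      partialSums j = integral (λ k → sum k (term j)) (λ k → ord-sum k (λ i →
        u-integral (suc (l ℕ.+ (j ℕ.+ i ℕ.* d)))))

      e-period : ∀ j i → e (suc (l ℕ.+ (j ℕ.+ i ℕ.* d))) ≈ e (suc (l ℕ.+ j))
      e-period j zero    = reflexive (≡.cong (λ n → e (suc (l ℕ.+ n))) (ℕ.+-identityʳ j))
      e-period j (suc i) = trans (reflexive (≡.cong e index))
        (trans (periodic _ (ℕ.m≤n⇒m≤1+n (ℕ.m≤m+n l _))) (e-period j i))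
        where
        index : suc (l ℕ.+ (j ℕ.+ (d ℕ.+ i ℕ.* d))) ≡ suc (l ℕ.+ (j ℕ.+ i ℕ.* d)) ℕ.+ d
        index = ≡.cong suc (≡.trans (≡.cong (l ℕ.+_)
          (≡.trans (≡.cong (j ℕ.+_) (ℕ.+-comm d _)) (≡.sym (ℕ.+-assoc j _ d)))) (≡.sym (ℕ.+-assoc l _ d)))

      partialSums-square : ∀ j → partialSums j *S partialSums j ∼ const (e (suc (l ℕ.+ j))) *S partialSums (suc j)
      partialSums-square j = pointwise λ k → trans (sum-square k (term j)) (trans (sum-cong k (λ i _ →
        trans (u-square _) (*-cong (e-period j i) (reflexive (≡.cong (u ∘ suc) (≡.sym (ℕ.+-suc l _)))))))
        (sum-* k _ (term (suc j))))

      -- Class `d` is class 0 without its first term. The partial sums of length `k` then differ by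
      -- `term 0 k`, which tends to 0.
      partialSums-d : partialSums d ∼ partialSums 0 +S const (term 0 0)
      partialSums-d = null (null-resp (λ k → sym (telescope k))
        (null-subsequence (λ k → suc (l ℕ.+ k ℕ.* d)) (ℕ.m≤n⇒m≤1+n ∘ k≤l+k*d) u-null))
        where
        telescope : ∀ k → sum k (term d) + (sum k (term 0) + term 0 0) ≈ term 0 k
        telescope k = trans (solve 3 (λ x y z → x :+ (y :+ z) := (z :+ x) :+ y) refl _ _ _)
          (trans (+-congʳ (sym (sum-suc k (term 0)))) (solve 2 (λ x y → (x :+ y) :+ x := y) refl _ _))

      -- Cutting after `l + k * d` terms gives every class exactly `k` terms, which is why this
      -- subsequence of `β` is chosen.
      subsequence-split : ∀ k → β (l ℕ.+ k ℕ.* d) ≈ at (const (β l) +S sumS d partialSums) k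
      subsequence-split k = trans (sum-split l (k ℕ.* d) (u ∘ suc))
        (+-congˡ (trans (sum-blocks k d (λ i → u (suc (l ℕ.+ i))))
          (sym (at-sum d {partialSums} {k = k} (λ _ → refl)))))

      module _ {f} {F : Carrier → Set f} (subfield : IsSubfield F) (e∈ : ∀ n → F (e n)) where
        private
          module F = IsSubfield subfield

        u∈ : ∀ n → F (u n)
        u∈ zero    = F.1∈
        u∈ (suc n) = F.*∈ (F.inverse∈ (e∈ n) (inverse n)) (F.*∈ (u∈ n) (u∈ n))

        abstract
          limit-algebraic : ∀ {α} → Null (λ n → α * β n + 1#) →
            Σ[ A ∈ Carrier ] Σ[ B ∈ (ℕ → Carrier) ] (F A × (∀ k → F (B k)) ×
              A * α ^ (2 ℕ.^ d) + sum d (λ k → B k * α ^ (2 ℕ.^ d ℕ.∸ 2 ℕ.^ k)) ≈ 1#)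
          limit-algebraic {α} αβ→1 = reciprocal-algebraic subfield d
            {X = partialSums} (λ j → e∈ (suc (l ℕ.+ j))) (F.sum∈ l (λ i → u∈ (suc i))) (u∈ (suc (l ℕ.+ 0)))
            (λ j _ → partialSums-square j) partialSums-d 0<d αβ∼1
            where
            αβ∼1 : const α *S (const (β l) +S sumS d partialSums) ∼ const 1#
            αβ∼1 = null (null-resp (λ k → +-congʳ (*-congˡ (subsequence-split k)))
              (null-subsequence (λ k → l ℕ.+ k ℕ.* d) k≤l+k*d αβ→1))

-- Polynomials and their fractions in a filtered ring

open import Defs hiding (Represents)

coeffP-· : ∀ b p n → coeffP (b ·P p) n ≡ b ∧ coeffP p n
coeffP-· b []      n       = ≡.sym (Bool.∧-zeroʳ b)
coeffP-· b (a ∷ p) zero    = ≡.refl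
coeffP-· b (a ∷ p) (suc n) = coeffP-· b p n

-- In `embed-invertible` the non-zero coefficient of t^n bounds the degree below by `n`, so the
-- inverse has order at least `n`. For non-constant polynomials this gives order 1.
record PolynomialEmbedding {c ℓ o} {K : CommutativeRing c ℓ} (filtration : Filtration K o) : Set (c ⊔ ℓ ⊔ o) where
  open CommutativeRing K
  open Filtration filtration using (Ord)
  scalar : Bool → Carrier
  scalar b = if b then 1# else 0#
  field
    embed            : Poly → Carrier
    t                : Carrier
    embed-cong       : ∀ p q → p ≈P q → embed p ≈ embed q
    embed-[]         : embed [] ≈ 0#
    embed-1          : embed 1P ≈ 1#
    embed-∷          : ∀ a p → embed (a ∷ p) ≈ scalar a + t * embed p
    embed-+          : ∀ p q → embed (p +P q) ≈ embed p + embed q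
    embed-invertible : ∀ p {n} → coeffP p n ≡ true → ∃[ y ] (Ord n y × embed p * y ≈ 1#)
    zero⊎nonzero     : ∀ p → embed p ≈ 0# ⊎ NonZeroP p
    1≉0              : ¬ 1# ≈ 0#

module PolynomialFractions {c ℓ o} {K : CommutativeRing c ℓ} (1+1≈0 : CharacteristicTwo K)
  {filtration : Filtration K o} (embedding : PolynomialEmbedding filtration) where
  open CommutativeRing K
  open CharTwo K 1+1≈0
  private
    module V = Filtration filtration
  open V using (Ord; weaken; weaken-≤; unit)
  open PolynomialEmbedding embedding
  open import Relation.Binary.Reasoning.Setoid setoid

  embed-· : ∀ b p → embed (b ·P p) ≈ scalar b * embed p
  embed-· true  p = trans (embed-cong (true ·P p) p (coeffP-· true p)) (sym (*-identityˡ _))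
  embed-· false p = trans (embed-cong (false ·P p) [] (coeffP-· false p)) (trans embed-[] (sym (zeroˡ _)))

  embed-* : ∀ p q → embed (p *P q) ≈ embed p * embed q
  embed-* []      q = trans embed-[] (sym (trans (*-congʳ embed-[]) (zeroˡ _)))
  embed-* (a ∷ p) q = begin
    embed (a ·P q +P (false ∷ p *P q))                             ≈⟨ embed-+ (a ·P q) (false ∷ p *P q) ⟩
    embed (a ·P q) + embed (false ∷ p *P q)                      ≈⟨ +-cong (embed-· a q) (embed-∷ false (p *P q)) ⟩
    scalar a * embed q + (0# + t * embed (p *P q))        ≈⟨ +-congˡ (+-congˡ (*-congˡ (embed-* p q))) ⟩
    scalar a * embed q + (0# + t * (embed p * embed q))
      ≈⟨ solve 4 (λ a q t p → a :* q :+ (con false :+ t :* (p :* q)) := (a :+ t :* p) :* q)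
      refl (scalar a) (embed q) t (embed p) ⟩
    (scalar a + t * embed p) * embed q                        ≈⟨ *-congʳ (embed-∷ a p) ⟨
    embed (a ∷ p) * embed q                                      ∎

  *-zero-divisor : ∀ {x x⁻¹ y} → x * x⁻¹ ≈ 1# → x * y ≈ 0# → y ≈ 0#
  *-zero-divisor {x} {x⁻¹} {y} xx⁻¹≈1 h = begin
    y                ≈⟨ *-identityˡ y ⟨
    1# * y        ≈⟨ *-congʳ xx⁻¹≈1 ⟨
    (x * x⁻¹) * y  ≈⟨ solve 3 (λ x z y → (x :* z) :* y := z :* (x :* y)) refl x x⁻¹ y ⟩
    x⁻¹ * (x * y)  ≈⟨ *-congˡ h ⟩
    x⁻¹ * 0#     ≈⟨ zeroʳ x⁻¹ ⟩
    0#            ∎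

  -- Decided inside the ring, where both factors are invertible: a vanishing product would make `1#`
  -- zero.
  nonzero-* : ∀ p q → NonZeroP p → NonZeroP q → NonZeroP (p *P q)
  nonzero-* p q (m , pₘ) (n , qₙ) with zero⊎nonzero (p *P q)
  ... | inj₂ nz = nz
  ... | inj₁ pq≈0 with embed-invertible p pₘ | embed-invertible q qₙ
  ... | p⁻¹ , _ , pp⁻¹ | q⁻¹ , _ , qq⁻¹ = ⊥-elim (1≉0 (trans (sym qq⁻¹)
    (trans (*-congʳ (*-zero-divisor pp⁻¹ (trans (sym (embed-* p q)) pq≈0))) (zeroˡ q⁻¹))))

  -- The subfield generated by the ε_i

  Represents : Carrier → RatF → Set ℓ
  Represents x (p , q) = NonZeroP q × embed q * x ≈ embed p

  represents-unique : ∀ r {x y} → Represents x r → Represents y r → x ≈ y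
  represents-unique (p , q) {x} {y} ((n , qₙ) , qx≈p) (_ , qy≈p) with embed-invertible q qₙ
  ... | q⁻¹ , _ , qq⁻¹ = x+y≈0⇒x≈y (*-zero-divisor qq⁻¹
    (trans (distribˡ _ x y) (x≈y⇒x+y≈0 (trans qx≈p (sym qy≈p)))))

  -- Membership keeps the fraction as a witness; the fractions of the final theorem are read off
  -- from these proofs.
  Value : (ℕ → Poly) → ℕ → Carrier → Set ℓ
  Value ε N x = ∃[ r ] (InF ε N r × Represents x r)

  value-subfield : ∀ ε N → IsSubfield (Value ε N)
  value-subfield ε N = record
    { resp = λ { x≈y (r , r∈ , q≢0 , qx) → r , r∈ , q≢0 , trans (*-congˡ (sym x≈y)) qx }
    ; 0∈   = (0P , 1P) , zer , 1≢0 , trans (zeroʳ _) (sym embed-[])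
    ; 1∈   = (1P , 1P) , one , 1≢0 , *-identityʳ _
    ; +∈   = λ { {x} {y} ((p , q) , r∈ , q≢0 , qx) ((p′ , q′) , r∈′ , q′≢0 , q′y) →
        (p *P q′ +P p′ *P q , q *P q′) , add r∈ r∈′ , nonzero-* q q′ q≢0 q′≢0 ,
          add-represents p q p′ q′ x y qx q′y }
    ; *∈   = λ { {x} {y} ((p , q) , r∈ , q≢0 , qx) ((p′ , q′) , r∈′ , q′≢0 , q′y) →
        (p *P p′ , q *P q′) , mul r∈ r∈′ , nonzero-* q q′ q≢0 q′≢0 , mul-represents p q p′ q′ x y qx q′y }
    ; inv? = inverse
    }
    where
    1≢0 : NonZeroP 1P
    1≢0 = 0 , ≡.refl
    add-represents : ∀ p q p′ q′ x y → embed q * x ≈ embed p → embed q′ * y ≈ embed p′ →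
      embed (q *P q′) * (x + y) ≈ embed (p *P q′ +P p′ *P q)
    add-represents p q p′ q′ x y qx q′y = begin
      embed (q *P q′) * (x + y)           ≈⟨ *-congʳ (embed-* q q′) ⟩
      (embed q * embed q′) * (x + y)
        ≈⟨ solve 4 (λ q q′ x y → (q :* q′) :* (x :+ y) := (q :* x) :* q′ :+ (q′ :* y) :* q)
        refl (embed q) (embed q′) x y ⟩
      (embed q * x) * embed q′ + (embed q′ * y) * embed q ≈⟨ +-cong (*-congʳ qx) (*-congʳ q′y) ⟩
      embed p * embed q′ + embed p′ * embed q ≈⟨ +-cong (embed-* p q′) (embed-* p′ q) ⟨
      embed (p *P q′) + embed (p′ *P q)   ≈⟨ embed-+ (p *P q′) (p′ *P q) ⟨
      embed (p *P q′ +P p′ *P q)            ∎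
    mul-represents : ∀ p q p′ q′ x y → embed q * x ≈ embed p → embed q′ * y ≈ embed p′ →
      embed (q *P q′) * (x * y) ≈ embed (p *P p′)
    mul-represents p q p′ q′ x y qx q′y = begin
      embed (q *P q′) * (x * y)           ≈⟨ *-congʳ (embed-* q q′) ⟩
      (embed q * embed q′) * (x * y)
        ≈⟨ solve 4 (λ q q′ x y → (q :* q′) :* (x :* y) := (q :* x) :* (q′ :* y)) refl (embed q) (embed q′) x y ⟩
      (embed q * x) * (embed q′ * y)    ≈⟨ *-cong qx q′y ⟩
      embed p * embed p′                  ≈⟨ embed-* p p′ ⟨
      embed (p *P p′)                       ∎
    inverse : ∀ {x} → Value ε N x → x ≈ 0# ⊎ ∃[ y ] (Value ε N y × x * y ≈ 1#)
    -- The zero test is made on the numerator `p`.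
    inverse {x} ((p , q) , r∈ , (n , qₙ) , qx) with zero⊎nonzero p
    ... | inj₁ p≈0 = inj₁ (*-zero-divisor (proj₂ (proj₂ (embed-invertible q qₙ))) (trans qx p≈0))
    ... | inj₂ (m , pₘ) with embed-invertible p pₘ
    ... | p⁻¹ , _ , pp⁻¹ = inj₂ (embed q * p⁻¹ , ((q , p) , inv r∈ (m , pₘ) , (m , pₘ) ,
        (begin
          embed p * (embed q * p⁻¹)
            ≈⟨ solve 3 (λ p q z → p :* (q :* z) := (p :* z) :* q) refl (embed p) (embed q) p⁻¹ ⟩
          (embed p * p⁻¹) * embed q  ≈⟨ *-congʳ pp⁻¹ ⟩
          1# * embed q               ≈⟨ *-identityˡ _ ⟩
          embed q                       ∎)) ,
        (begin
          x * (embed q * p⁻¹)  ≈⟨ solve 3 (λ x q z → x :* (q :* z) := (q :* x) :* z) refl x (embed q) p⁻¹ ⟩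
          (embed q * x) * p⁻¹  ≈⟨ *-congʳ qx ⟩
          embed p * p⁻¹         ≈⟨ pp⁻¹ ⟩
          1#                    ∎))

  -- Continued fractions

  -- a ▹ v is the matrix (a 1 ; 1 0) applied to v, so a continued fraction [w] is the quotient of the
  -- two entries of act w (1# , 0#).
  infixr 5 _▹_
  _▹_ : Poly → Carrier × Carrier → Carrier × Carrier
  a ▹ (x , y) = embed a * x + y , x

  act : List Poly → Carrier × Carrier → Carrier × Carrier
  act w v = foldr _▹_ v w

  cfFrom-suc : ∀ s i n → cfFrom s i (suc n) ≡
    (s i *P proj₁ (cfFrom s (suc i) n) +P proj₂ (cfFrom s (suc i) n) , proj₁ (cfFrom s (suc i) n))
  cfFrom-suc s i n with cfFrom s (suc i) n
  ... | _ , _ = ≡.refl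

  cfFrom-act : ∀ s i n w → length w ≡ suc n → (∀ j → j < length w → s (i ℕ.+ j) ≡ nth w j 0P) →
    embed (proj₁ (cfFrom s i n)) ≈ proj₁ (act w (1# , 0#)) × embed (proj₂ (cfFrom s i n)) ≈ proj₂ (act w (1# , 0#))
  cfFrom-act s i zero (a ∷ []) _ letters = trans (reflexive (≡.cong embed head))
      (solve 1 (λ a → a := a :* con true :+ con false) refl (embed a)) , embed-1
    where
    head : s i ≡ a
    head = ≡.trans (≡.cong s (≡.sym (ℕ.+-identityʳ i))) (letters 0 (s≤s z≤n))
  cfFrom-act s i (suc n) (a ∷ w) len letters
    with cfFrom-act s (suc i) n w (ℕ.suc-injective len)
      (λ j j< → ≡.trans (≡.cong s (≡.sym (ℕ.+-suc i j))) (letters (suc j) (s≤s j<)))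
  ... | fst≈ , snd≈ rewrite cfFrom-suc s i n | ≡.trans (≡.cong s (≡.sym (ℕ.+-identityʳ i))) (letters 0 (s≤s z≤n)) =
    trans (embed-+ _ _) (+-cong (trans (embed-* _ _) (*-congˡ fst≈)) snd≈) , fst≈

  nth-++ˡ : ∀ (u v : List Poly) {j} → j < length u → nth (u ++ v) j 0P ≡ nth u j 0P
  nth-++ˡ (_ ∷ _) v {zero}  _        = ≡.refl
  nth-++ˡ (_ ∷ u) v {suc j} (s≤s j<) = nth-++ˡ u v j<

  module _ (ε : ℕ → Poly) where

    W-prefix : ∀ {m n j} → m ≤ n → j < length (W ε m) → nth (W ε n) j 0P ≡ nth (W ε m) j 0P
    W-prefix {m} {n} m≤n j< with ℕ.m≤n⇒m<n∨m≡n m≤n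
    W-prefix {m} {suc n} {j} _ j< | inj₁ m<1+n =
      ≡.trans (nth-++ˡ (W ε n) _ (ℕ.≤-trans j< (W-mono (s≤s⁻¹ m<1+n)))) (W-prefix (s≤s⁻¹ m<1+n) j<)
      where
      W-mono : ∀ {m n} → m ≤ n → length (W ε m) ≤ length (W ε n)
      W-mono {m} {n} m≤n with ℕ.m≤n⇒m<n∨m≡n m≤n
      W-mono {m} {suc n} _ | inj₁ m<1+n rewrite List.length-++ (W ε n) {ε n ∷ W ε n} =
        ℕ.≤-trans (W-mono (s≤s⁻¹ m<1+n)) (ℕ.m≤m+n _ _)
      W-mono _ | inj₂ ≡.refl = ℕ.≤-refl
    W-prefix _ _ | inj₂ ≡.refl = ≡.refl

    n≤length-W : ∀ n → n ≤ length (W ε n)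
    n≤length-W zero    = z≤n
    n≤length-W (suc n) rewrite List.length-++ (W ε n) {ε n ∷ W ε n} | ℕ.+-suc (length (W ε n)) (length (W ε n)) =
      s≤s (ℕ.≤-trans (n≤length-W n) (ℕ.m≤m+n _ _))

    sSeq-W : ∀ n j → j < length (W ε n) → sSeq ε j ≡ nth (W ε n) j 0P
    sSeq-W n j j< with ℕ.≤-total n (suc j)
    ... | inj₁ n≤1+j = W-prefix n≤1+j j<
    ... | inj₂ 1+j≤n = ≡.sym (W-prefix 1+j≤n (n≤length-W (suc j)))

  module ContinuedFraction (ε : ℕ → Poly) (nonConst : ∀ n → NonConst (ε n)) where
    e e⁻¹ : ℕ → Carrier
    e n = embed (ε n)
    e⁻¹ n = proj₁ (embed-invertible (ε n) (proj₂ (proj₂ (nonConst n))))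

    inverse : ∀ n → e n * e⁻¹ n ≈ 1#
    inverse n = proj₂ (proj₂ (embed-invertible (ε n) (proj₂ (proj₂ (nonConst n)))))

    small : ∀ n → Ord 1 (e⁻¹ n)
    small n = weaken-≤ (proj₁ (proj₂ (nonConst n))) (proj₁ (proj₂ (embed-invertible (ε n) (proj₂ (proj₂ (nonConst n))))))

    open BoundedSequences K 1+1≈0 filtration
    open Continued e e⁻¹ inverse small

    -- The matrix of the word W_n is (p q ; q r); it is symmetric because W_n is a palindrome.
    p q r : ℕ → Carrier
    p zero    = 1#
    p (suc n) = e n * (p n * p n)
    q zero    = 0#
    q (suc n) = e n * (p n * q n) + 1#
    r zero    = 1#
    r (suc n) = e n * (q n * q n)

    -- No induction: with X = e p q the successor case is X² + (X + 1)² = 1.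
    determinant : ∀ n → p n * r n + q n * q n ≈ 1#
    determinant zero    = solve 0 (con true :* con true :+ con false :* con false := con true) refl
    determinant (suc n) = solve 3 (λ e p q → (e :* (p :* p)) :* (e :* (q :* q)) :+
      (e :* (p :* q) :+ con true) :* (e :* (p :* q) :+ con true) := con true) refl (e n) (p n) (q n)

    -- In the matrix of W ε W the cross terms on the diagonal cancel in pairs, and the off-diagonal
    -- entry is e p q plus the determinant, which is 1.
    act-W : ∀ n x y →
      proj₁ (act (W ε n) (x , y)) ≈ p n * x + q n * y × proj₂ (act (W ε n) (x , y)) ≈ q n * x + r n * y
    act-W zero    x y = solve 2 (λ x y → x := con true :* x :+ con false :* y) refl x y ,
                        solve 2 (λ x y → y := con false :* x :+ con true :* y) refl x y
    act-W (suc n) x y rewrite List.foldr-++ _▹_ (x , y) (W ε n) (ε n ∷ W ε n) = first , second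
      where
      X = proj₁ (act (W ε n) (x , y))
      Y = proj₂ (act (W ε n) (x , y))
      X≈ = proj₁ (act-W n x y)
      Y≈ = proj₂ (act-W n x y)
      first : proj₁ (act (W ε n) (e n * X + Y , X)) ≈ p (suc n) * x + q (suc n) * y
      first = begin
        proj₁ (act (W ε n) (e n * X + Y , X))     ≈⟨ proj₁ (act-W n (e n * X + Y) X) ⟩
        p n * (e n * X + Y) + q n * X             ≈⟨ +-cong (*-congˡ (+-cong (*-congˡ X≈) Y≈)) (*-congˡ X≈) ⟩
        p n * (e n * (p n * x + q n * y) + (q n * x + r n * y)) + q n * (p n * x + q n * y)
          ≈⟨ solve 6 (λ e p q r x y → p :* (e :* (p :* x :+ q :* y) :+ (q :* x :+ r :* y)) :+ q :* (p :* x :+ q :* y)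
               := (e :* (p :* p)) :* x :+ (e :* (p :* q) :+ (p :* r :+ q :* q)) :* y)
                 refl (e n) (p n) (q n) (r n) x y ⟩
        p (suc n) * x + (e n * (p n * q n) + (p n * r n + q n * q n)) * y
          ≈⟨ +-congˡ (*-congʳ (+-congˡ (determinant n))) ⟩
        p (suc n) * x + q (suc n) * y             ∎
      second : proj₂ (act (W ε n) (e n * X + Y , X)) ≈ q (suc n) * x + r (suc n) * y
      second = begin
        proj₂ (act (W ε n) (e n * X + Y , X))     ≈⟨ proj₂ (act-W n (e n * X + Y) X) ⟩
        q n * (e n * X + Y) + r n * X             ≈⟨ +-cong (*-congˡ (+-cong (*-congˡ X≈) Y≈)) (*-congˡ X≈) ⟩
        q n * (e n * (p n * x + q n * y) + (q n * x + r n * y)) + r n * (p n * x + q n * y)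
          ≈⟨ solve 6 (λ e p q r x y → q :* (e :* (p :* x :+ q :* y) :+ (q :* x :+ r :* y)) :+ r :* (p :* x :+ q :* y)
               := (e :* (p :* q) :+ (p :* r :+ q :* q)) :* x :+ (e :* (q :* q)) :* y)
                 refl (e n) (p n) (q n) (r n) x y ⟩
        (e n * (p n * q n) + (p n * r n + q n * q n)) * x + r (suc n) * y
          ≈⟨ +-congʳ (*-congʳ (+-congˡ (determinant n))) ⟩
        q (suc n) * x + r (suc n) * y             ∎

    -- `convergent s m` uses `m + 1` partial quotients, hence the predecessor of the length.
    index : ℕ → ℕ
    index n = ℕ.pred (length (W ε (suc n)))

    index-length : ∀ n → length (W ε (suc n)) ≡ suc (index n)
    index-length n with length (W ε (suc n)) | n≤length-W ε (suc n)
    ... | suc _ | _ = ≡.refl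

    n≤index : ∀ n → n ≤ index n
    n≤index n = s≤s⁻¹ (≡.subst (suc n ≤_) (index-length n) (n≤length-W ε (suc n)))

    convergent-numerator : ∀ n → embed (proj₁ (convergent (sSeq ε) (index n))) ≈ p (suc n)
    convergent-numerator n =
      trans (proj₁ (cfFrom-act (sSeq ε) 0 (index n) (W ε (suc n)) (index-length n) (sSeq-W ε (suc n))))
      (trans (proj₁ (act-W (suc n) 1# 0#)) (solve 2 (λ p q → p :* con true :+ q :* con false := p) refl _ _))

    convergent-denominator : ∀ n → embed (proj₂ (convergent (sSeq ε) (index n))) ≈ q (suc n)
    convergent-denominator n =
      trans (proj₂ (cfFrom-act (sSeq ε) 0 (index n) (W ε (suc n)) (index-length n) (sSeq-W ε (suc n))))
      (trans (proj₂ (act-W (suc n) 1# 0#)) (solve 2 (λ p q → p :* con true :+ q :* con false := p) refl _ _))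

    p-inverse : ∀ n → p n * u n ≈ 1#
    p-inverse zero    = *-identityˡ 1#
    p-inverse (suc n) = begin
      (e n * (p n * p n)) * (e⁻¹ n * (u n * u n))
        ≈⟨ solve 4 (λ e p f u → (e :* (p :* p)) :* (f :* (u :* u)) := (e :* f) :* ((p :* u) :* (p :* u))) refl _ _ _ _ ⟩
      (e n * e⁻¹ n) * ((p n * u n) * (p n * u n))     ≈⟨ *-cong (inverse n) (*-cong (p-inverse n) (p-inverse n)) ⟩
      1# * (1# * 1#)                                  ≈⟨ trans (*-identityˡ _) (*-identityˡ _) ⟩
      1#                                              ∎

    q≈pβ : ∀ n → q n ≈ p n * β n
    q≈pβ zero    = sym (zeroʳ _)
    q≈pβ (suc n) = begin
      e n * (p n * q n) + 1#
        -- The summand 1 becomes `p (suc n) * u (suc n)`, which supplies the new term of `β`.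
        ≈⟨ +-cong (*-congˡ (*-congˡ (q≈pβ n))) (sym (p-inverse (suc n))) ⟩
      e n * (p n * (p n * β n)) + p (suc n) * u (suc n)
        ≈⟨ solve 4 (λ e p b u → e :* (p :* (p :* b)) :+ (e :* (p :* p)) :* u := (e :* (p :* p)) :* (b :+ u)) refl _ _ _ _ ⟩
      p (suc n) * (β n + u (suc n))                    ∎

    -- Prepares the inversion of `β`: with `u 1` taken out, all later terms have order 1 and `unit`
    -- inverts the remaining sum.
    u-ratio : ∀ n → ∃[ x ] (Ord 1 x × u (suc (suc n)) ≈ u 1 * x)
    u-ratio zero    = e⁻¹ 1 * u 1 , weaken 1 (V.*∈ (small 1) (u-integral 1)) ,
      solve 2 (λ f u → f :* (u :* u) := u :* (f :* u)) refl _ _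
    u-ratio (suc n) with u-ratio n
    ... | x , ord-x , h = x * (e⁻¹ (suc (suc n)) * u (suc (suc n))) ,
      weaken 1 (V.*∈ ord-x (V.*∈ (small (suc (suc n))) (u-integral (suc (suc n))))) ,
      trans (*-congˡ (*-congʳ h)) (solve 4 (λ f u x v → f :* ((u :* x) :* v) := u :* (x :* (f :* v))) refl _ _ _ _)

    β-ratio : ∀ n → ∃[ x ] (Ord 1 x × β (suc n) ≈ u 1 * (1# + x))
    β-ratio zero    = 0# , V.0∈ , solve 1 (λ u → con false :+ u := u :* (con true :+ con false)) refl _
    β-ratio (suc n) with β-ratio n | u-ratio n
    ... | x , ord-x , h | y , ord-y , k = x + y , V.+∈ ord-x ord-y ,
      trans (+-cong h k) (solve 3 (λ u x y → u :* (con true :+ x) :+ u :* y := u :* (con true :+ (x :+ y))) refl _ _ _)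

    β-invertible : ∀ n → ∃[ x ] β (suc n) * x ≈ 1#
    β-invertible n with β-ratio n
    ... | x , ord-x , h with unit ord-x
    ... | y , 1+x-inv = p 1 * y , (begin
      β (suc n) * (p 1 * y)           ≈⟨ *-congʳ h ⟩
      (u 1 * (1# + x)) * (p 1 * y)
        ≈⟨ solve 4 (λ u x p y → (u :* x) :* (p :* y) := (p :* u) :* (x :* y)) refl _ _ _ _ ⟩
      (p 1 * u 1) * ((1# + x) * y)    ≈⟨ *-cong (p-inverse 1) 1+x-inv ⟩
      1# * 1#                         ≈⟨ *-identityˡ 1# ⟩
      1#                              ∎)

    -- The limit hypothesis only speaks about elements that represent a convergent, so one must be
    -- exhibited: the inverse of `β (suc n)`.
    convergent-represented : ∀ n {x} → β (suc n) * x ≈ 1# → Represents x (convergent (sSeq ε) (index n))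
    convergent-represented n {x} βx≈1 = nonzero (zero⊎nonzero (proj₂ C)) , (begin
        embed (proj₂ C) * x              ≈⟨ *-congʳ denominator ⟩
        (p (suc n) * β (suc n)) * x      ≈⟨ trans (*-assoc _ _ _) (*-congˡ βx≈1) ⟩
        p (suc n) * 1#                   ≈⟨ *-identityʳ _ ⟩
        p (suc n)                        ≈⟨ convergent-numerator n ⟨
        embed (proj₁ C)                  ∎)
      where
      C = convergent (sSeq ε) (index n)
      denominator : embed (proj₂ C) ≈ p (suc n) * β (suc n)
      denominator = trans (convergent-denominator n) (q≈pβ (suc n))
      nonzero : embed (proj₂ C) ≈ 0# ⊎ NonZeroP (proj₂ C) → NonZeroP (proj₂ C)
      nonzero (inj₂ h) = h
      nonzero (inj₁ h) = ⊥-elim (1≉0 (begin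
        1#                                       ≈⟨ *-identityˡ 1# ⟨
        1# * 1#                                  ≈⟨ *-cong (p-inverse (suc n)) βx≈1 ⟨
        (p (suc n) * u (suc n)) * (β (suc n) * x)
          ≈⟨ solve 4 (λ p u b x → (p :* u) :* (b :* x) := (p :* b) :* (u :* x)) refl _ _ _ _ ⟩
        (p (suc n) * β (suc n)) * (u (suc n) * x) ≈⟨ *-congʳ (trans (sym denominator) h) ⟩
        0# * (u (suc n) * x)                     ≈⟨ zeroˡ _ ⟩
        0#                                       ∎))

    IsLimit : Carrier → Set _
    IsLimit α = ∀ m → ∃[ N ] (∀ n → N ≤ n → ∀ x → Represents x (convergent (sSeq ε) n) → Ord m (x + α))

    -- If `x` is the inverse of `β n`, then `α * β n + 1#` equals `(x + α) * β n`, and the factor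
    -- `β n` is integral.
    αβ→1 : ∀ {α} → IsLimit α → Null (λ n → α * β n + 1#)
    αβ→1 {α} limit m with limit m
    -- `β 0` is the empty sum and has no inverse, so the bound starts one later.
    ... | N , close = suc N , λ { (suc n) (s≤s N≤n) → bound n N≤n (β-invertible n) }
      where
      bound : ∀ n → N ≤ n → ∃[ x ] β (suc n) * x ≈ 1# → Ord m (α * β (suc n) + 1#)
      bound n N≤n (x , βx≈1) = V.resp
        (trans (solve 3 (λ x a b → (x :+ a) :* b := a :* b :+ b :* x) refl x α (β (suc n))) (+-congˡ βx≈1))
        (weaken m (V.*∈ (close (index n) (ℕ.≤-trans N≤n (n≤index n)) x (convergent-represented n βx≈1))
          (ord-sum (suc n) (λ i → u-integral (suc i)))))

    module _ {l d : ℕ} (ultPeriodic : UltPeriodic l d ε) where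
      private
        F : Carrier → Set ℓ
        F = Value ε (l ℕ.+ d)

        F-subfield : IsSubfield F
        F-subfield = value-subfield ε (l ℕ.+ d)

        periodic : ∀ n → l ≤ n → e (n ℕ.+ d) ≈ e n
        periodic n l≤n = embed-cong _ _ (proj₂ ultPeriodic n l≤n)

      abstract
        -- The generators reach only below `l + d`; from there on `n ∸ d` is still at least `l`, and
        -- periodicity steps down.
        e∈ : ∀ n → F (e n)
        e∈ = <-rec (λ n → F (e n)) λ n rec → by-period n rec (ℕ.≤-<-connex (l ℕ.+ d) n)
          where
          by-period : ∀ n → (∀ {m} → m < n → F (e m)) → l ℕ.+ d ≤ n ⊎ n < l ℕ.+ d → F (e n)
          by-period n rec (inj₂ n<l+d) = (ε n , 1P) , gen n n<l+d , (0 , ≡.refl) ,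
            trans (*-congʳ embed-1) (*-identityˡ _)
          by-period n rec (inj₁ l+d≤n) = ≡.subst (λ m → F (e m)) (ℕ.m∸n+n≡m d≤n)
            (IsSubfield.resp F-subfield (sym (periodic (n ℕ.∸ d) (ℕ.m+n≤o⇒m≤o∸n l l+d≤n))) (rec (ℕ.∸-monoʳ-< (proj₁ ultPeriodic) d≤n)))
            where
            d≤n : d ≤ n
            d≤n = ℕ.≤-trans (ℕ.m≤n+m d l) l+d≤n

      open Linear F-subfield using (Vanishing; reciprocal-polynomial)

      -- A fraction with non-zero denominator represents only one element, so arbitrary
      -- representatives `c` of the coefficients satisfy the same equation.
      vanishing-fractions : ∀ {α n} → ∃[ P ] (Vanishing α n P × ∃[ y ] P n * y ≈ 1#) →
        Σ[ P ∈ (ℕ → RatF) ] ((∀ i → InF ε (l ℕ.+ d) (P i)) × NonZeroP (proj₁ (P n)) ×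
          (∀ (c : ℕ → Carrier) → (∀ i → i ≤ n → Represents (c i) (P i)) → sum (suc n) (λ i → c i * α ^ i) ≈ 0#))
      vanishing-fractions {α} {n} (P , (P∈ , root) , y , top) =
        proj₁ ∘ P∈ , proj₁ ∘ proj₂ ∘ P∈ , nonzero (P∈ n) top ,
        λ c c-rep → trans (sum-cong (suc n) λ i i≤n →
          *-congʳ (represents-unique (proj₁ (P∈ i)) (c-rep i (s≤s⁻¹ i≤n)) (proj₂ (proj₂ (P∈ i))))) root
        where
        nonzero : ∀ {x y} (x∈ : F x) → x * y ≈ 1# → NonZeroP (proj₁ (proj₁ x∈))
        nonzero {x} {y} ((a , b) , _ , (m , bₘ) , bx≈a) xy≈1 with zero⊎nonzero a
        ... | inj₂ a≢0 = a≢0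
        ... | inj₁ a≈0 = ⊥-elim (1≉0 (trans (sym xy≈1) (trans (*-congʳ
          (*-zero-divisor (proj₂ (proj₂ (embed-invertible b bₘ))) (trans bx≈a a≈0))) (zeroˡ y))))

      -- Here an inverse of `α` is given in the ring itself, so the clearing of denominators can be
      -- undone.
      reciprocal-fractions : ∀ {α A} {B : ℕ → Carrier} (A∈ : F A) (B∈ : ∀ k → F (B k)) →
        A * α ^ (2 ℕ.^ d) + sum d (λ k → B k * α ^ (2 ℕ.^ d ℕ.∸ 2 ℕ.^ k)) ≈ 1# →
        ∀ {β} → α * β ≈ 1# → ∀ {a} {b : ℕ → Carrier} →
        Represents a (proj₁ A∈) → (∀ k → k < d → Represents (b k) (proj₁ (B∈ k))) →
        β ^ (2 ℕ.^ d) ≈ a + sum d (λ k → b k * β ^ (2 ℕ.^ k))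
      reciprocal-fractions {A = A} {B} (r , _ , A-rep) B∈ eq αβ≈1 a-rep b-rep = trans (^2^k≈frob d _)
        (trans (reciprocal-equation⁻¹ αβ≈1 d A B eq) (+-cong (represents-unique r A-rep a-rep)
          (sum-cong d λ k k<d → *-cong (represents-unique (proj₁ (B∈ k)) (proj₂ (proj₂ (B∈ k))) (b-rep k k<d)) (sym (^2^k≈frob k _)))))

      abstract
        limit-equation : ∀ {α} → IsLimit α →
          ∃[ A ] Σ[ B ∈ (ℕ → Carrier) ] (F A × (∀ k → F (B k)) ×
            A * α ^ (2 ℕ.^ d) + sum d (λ k → B k * α ^ (2 ℕ.^ d ℕ.∸ 2 ℕ.^ k)) ≈ 1#)
        limit-equation limit = Periodic.limit-algebraic (proj₁ ultPeriodic) periodic F-subfield e∈ (αβ→1 limit)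

open import Algebra.Properties.CommutativeSemigroup ℕ.+-commutativeSemigroup using (x∙yz≈y∙xz)
open import Data.Integer using (+_)
open import Data.Nat using (_+_; _∸_; _^_)
open import Defs using (Represents)
open import Relation.Binary.PropositionalEquality using (_≗_; refl; sym; trans; cong; cong₂; subst; module ≡-Reasoning)

open xor-∧-Solver using (solve; _:=_; _:+_; _:*_; con)

-- Power series over 𝔽₂

Series : Set
Series = ℕ → Bool

tail : Series → Series
tail f n = f (suc n)

infixl 7 _⊛_
_⊛_ : Series → Series → Series
(f ⊛ g) j = bigXor (suc j) (λ i → f i ∧ g (j ∸ i))

infixl 6 _⊕_
_⊕_ : Series → Series → Series
(f ⊕ g) j = f j xor g j

bigXor-cong : ∀ n {f g : Series} → (∀ i → i < n → f i ≡ g i) → bigXor n f ≡ bigXor n g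
bigXor-cong zero    h = refl
bigXor-cong (suc n) h = cong₂ _xor_ (bigXor-cong n (λ i i<n → h i (ℕ.m<n⇒m<1+n i<n))) (h n (ℕ.n<1+n n))

bigXor-suc : ∀ n (f : Series) → bigXor (suc n) f ≡ f 0 xor bigXor n (tail f)
bigXor-suc zero    f = sym (Bool.xor-identityʳ (f 0))
bigXor-suc (suc n) f = trans (cong (_xor f (suc n)) (bigXor-suc n f)) (Bool.xor-assoc (f 0) _ _)

-- With X for 1/t this is f g = f(0) g + X (tail f) g, the recursion behind most of the convolution
-- laws.
⊛-suc : ∀ f g n → (f ⊛ g) (suc n) ≡ (f 0 ∧ g (suc n)) xor (tail f ⊛ g) n
⊛-suc f g n = bigXor-suc (suc n) (λ i → f i ∧ g (suc n ∸ i))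

⊛-suc′ : ∀ f g n → (f ⊛ g) (suc n) ≡ (f ⊛ tail g) n xor (f (suc n) ∧ g 0)
⊛-suc′ f g n = cong₂ _xor_
  (bigXor-cong (suc n) (λ i i≤n → cong (λ k → f i ∧ g k) (ℕ.+-∸-assoc 1 (s≤s⁻¹ i≤n))))
  (cong (λ k → f (suc n) ∧ g k) (ℕ.n∸n≡0 n))

⊛-cong : ∀ {f f′ g g′} → f ≗ f′ → g ≗ g′ → f ⊛ g ≗ f′ ⊛ g′
⊛-cong f≗ g≗ n = bigXor-cong (suc n) (λ i _ → cong₂ _∧_ (f≗ i) (g≗ (n ∸ i)))

⊛-comm : ∀ f g → f ⊛ g ≗ g ⊛ f
⊛-comm f g zero    = Bool.∧-comm (f 0) (g 0)
⊛-comm f g (suc n) = trans (⊛-suc f g n) (trans (cong ((f 0 ∧ g (suc n)) xor_) (⊛-comm (tail f) g n))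
  (trans (solve 3 (λ a b c → a :* b :+ c := c :+ b :* a) refl (f 0) (g (suc n)) _) (sym (⊛-suc′ g f n))))

⊛-distribˡ : ∀ f g h → f ⊛ (g ⊕ h) ≗ f ⊛ g ⊕ f ⊛ h
⊛-distribˡ f g h zero    = Bool.∧-distribˡ-xor (f 0) (g 0) (h 0)
⊛-distribˡ f g h (suc n) = trans (⊛-suc f (g ⊕ h) n)
  (trans (cong ((f 0 ∧ (g ⊕ h) (suc n)) xor_) (⊛-distribˡ (tail f) g h n))
  (trans (solve 5 (λ f g h a b → f :* (g :+ h) :+ (a :+ b) := (f :* g :+ a) :+ (f :* h :+ b))
    refl (f 0) (g (suc n)) (h (suc n)) _ _)
  (sym (cong₂ _xor_ (⊛-suc f g n) (⊛-suc f h n)))))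

⊛-distribʳ : ∀ f g h → (g ⊕ h) ⊛ f ≗ g ⊛ f ⊕ h ⊛ f
⊛-distribʳ f g h n = trans (⊛-comm (g ⊕ h) f n)
  (trans (⊛-distribˡ f g h n) (cong₂ _xor_ (⊛-comm f g n) (⊛-comm f h n)))

⊛-scale : ∀ b f g n → ((λ i → b ∧ f i) ⊛ g) n ≡ b ∧ (f ⊛ g) n
⊛-scale b f g zero    = Bool.∧-assoc b (f 0) (g 0)
⊛-scale b f g (suc n) = trans (⊛-suc (λ i → b ∧ f i) g n)
  (trans (cong (((b ∧ f 0) ∧ g (suc n)) xor_) (⊛-scale b (tail f) g n))
  (trans (solve 4 (λ b f g h → (b :* f) :* g :+ b :* h := b :* (f :* g :+ h)) refl b (f 0) (g (suc n)) _)
  (cong (b ∧_) (sym (⊛-suc f g n)))))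

⊛-assoc : ∀ f g h → (f ⊛ g) ⊛ h ≗ f ⊛ (g ⊛ h)
⊛-assoc f g h zero    = Bool.∧-assoc (f 0) (g 0) (h 0)
⊛-assoc f g h (suc n) = begin
  ((f ⊛ g) ⊛ h) (suc n)
    ≡⟨ ⊛-suc (f ⊛ g) h n ⟩
  ((f 0 ∧ g 0) ∧ h (suc n)) xor (tail (f ⊛ g) ⊛ h) n
    ≡⟨ cong (((f 0 ∧ g 0) ∧ h (suc n)) xor_) (⊛-cong {g = h} (⊛-suc f g) (λ _ → refl) n) ⟩
  ((f 0 ∧ g 0) ∧ h (suc n)) xor (((λ i → f 0 ∧ tail g i) ⊕ tail f ⊛ g) ⊛ h) n
    ≡⟨ cong (((f 0 ∧ g 0) ∧ h (suc n)) xor_) (⊛-distribʳ h (λ i → f 0 ∧ tail g i) (tail f ⊛ g) n) ⟩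
  ((f 0 ∧ g 0) ∧ h (suc n)) xor (((λ i → f 0 ∧ tail g i) ⊛ h) n xor ((tail f ⊛ g) ⊛ h) n)
    ≡⟨ cong (((f 0 ∧ g 0) ∧ h (suc n)) xor_) (cong₂ _xor_ (⊛-scale (f 0) (tail g) h n) (⊛-assoc (tail f) g h n)) ⟩
  ((f 0 ∧ g 0) ∧ h (suc n)) xor ((f 0 ∧ (tail g ⊛ h) n) xor (tail f ⊛ (g ⊛ h)) n)
    ≡⟨ solve 5 (λ f g h a b → (f :* g) :* h :+ (f :* a :+ b) := f :* (g :* h :+ a) :+ b)
      refl (f 0) (g 0) (h (suc n)) _ _ ⟩
  (f 0 ∧ ((g 0 ∧ h (suc n)) xor (tail g ⊛ h) n)) xor (tail f ⊛ (g ⊛ h)) n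
    ≡⟨ cong (λ b → (f 0 ∧ b) xor (tail f ⊛ (g ⊛ h)) n) (⊛-suc g h n) ⟨
  (f 0 ∧ (g ⊛ h) (suc n)) xor (tail f ⊛ (g ⊛ h)) n
    ≡⟨ ⊛-suc f (g ⊛ h) n ⟨
  (f ⊛ (g ⊛ h)) (suc n) ∎
  where open ≡-Reasoning

⊛-zeroˡ : ∀ {z} g → (∀ n → z n ≡ false) → ∀ n → (z ⊛ g) n ≡ false
⊛-zeroˡ g z≡0 zero    rewrite z≡0 0 = refl
⊛-zeroˡ {z} g z≡0 (suc n) = trans (⊛-suc z g n) (trans (cong (λ b →
  (b ∧ g (suc n)) xor (tail z ⊛ g) n) (z≡0 0)) (⊛-zeroˡ g (z≡0 ∘ suc) n))

δ : Series
δ zero    = true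
δ (suc _) = false

⊛-identityˡ : ∀ f → δ ⊛ f ≗ f
⊛-identityˡ f zero    = refl
⊛-identityˡ f (suc n) = trans (⊛-suc δ f n)
  (trans (cong (f (suc n) xor_) (⊛-zeroˡ f (λ _ → refl) n)) (Bool.xor-identityʳ (f (suc n))))

shift : ℕ → Series → Series
shift zero    f n       = f n
shift (suc k) f zero    = false
shift (suc k) f (suc n) = shift k f n

shift-cong : ∀ k {f g} → f ≗ g → shift k f ≗ shift k g
shift-cong zero    h n       = h n
shift-cong (suc k) h zero    = refl
shift-cong (suc k) h (suc n) = shift-cong k h n

shift-+ : ∀ k l f → shift (k + l) f ≗ shift k (shift l f)
shift-+ zero    l f n       = refl
shift-+ (suc k) l f zero    = refl
shift-+ (suc k) l f (suc n) = shift-+ k l f n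

shift-⊕ : ∀ k f g → shift k (f ⊕ g) ≗ shift k f ⊕ shift k g
shift-⊕ zero    f g n       = refl
shift-⊕ (suc k) f g zero    = refl
shift-⊕ (suc k) f g (suc n) = shift-⊕ k f g n

shift-⊛ : ∀ k f g → shift k f ⊛ g ≗ shift k (f ⊛ g)
shift-⊛ zero    f g n       = refl
shift-⊛ (suc k) f g zero    = refl
shift-⊛ (suc k) f g (suc n) = trans (⊛-suc (shift (suc k) f) g n) (shift-⊛ k f g n)

⊛-shift : ∀ k f g → f ⊛ shift k g ≗ shift k (f ⊛ g)
⊛-shift k f g n = trans (⊛-comm f (shift k g) n) (trans (shift-⊛ k g f n) (shift-cong k (⊛-comm g f) n))

shift-< : ∀ {k n} f → n < k → shift k f n ≡ false
shift-< {suc k} {zero}  f _         = refl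
shift-< {suc k} {suc n} f (s≤s n<k) = shift-< f n<k

shift-drop : ∀ k {f} → (∀ n → n < k → f n ≡ false) → f ≗ shift k (λ n → f (k + n))
shift-drop zero    h n       = refl
shift-drop (suc k) h zero    = h 0 (s≤s z≤n)
shift-drop (suc k) h (suc n) = shift-drop k (λ n n<k → h (suc n) (s≤s n<k)) n

-- Long division by f: the remainder of h after one step is (h - h(0) f) / X.
quotient : Series → Series → Series
quotient f h zero    = h 0
quotient f h (suc n) = quotient f (tail (h ⊕ λ i → h 0 ∧ f i)) n

⊛-quotient : ∀ f → f 0 ≡ true → ∀ h → f ⊛ quotient f h ≗ h
⊛-quotient f f₀ h zero    rewrite f₀ = refl
⊛-quotient f f₀ h (suc n) = trans (⊛-suc′ f (quotient f h) n)
  (trans (cong (_xor (f (suc n) ∧ h 0)) (⊛-quotient f f₀ (tail (h ⊕ λ i → h 0 ∧ f i)) n))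
  (solve 3 (λ a b c → (a :+ b :* c) :+ c :* b := a) refl (h (suc n)) (h 0) (f (suc n))))

-- Laurent series

coeffL-≤ : ∀ N f {e} → e ℤ.≤ + N → coeffL (mkL N f) e ≡ f ℤ.∣ + N ℤ.- e ∣
coeffL-≤ N f {e} e≤N with e ℤ.≤? + N
... | yes _   = refl
... | no  e≰N = ⊥-elim (e≰N e≤N)

coeffL-> : ∀ N f {e} → ¬ e ℤ.≤ + N → coeffL (mkL N f) e ≡ false
coeffL-> N f {e} e≰N with e ℤ.≤? + N
... | yes e≤N = ⊥-elim (e≰N e≤N)
... | no  _   = refl

N-[N-j]≡j : ∀ N j → N ℤ.- (N ℤ.- j) ≡ j
N-[N-j]≡j = solve-∀

N-∣N-e∣≡e : ∀ {N e} → e ℤ.≤ + N → + N ℤ.- + ℤ.∣ + N ℤ.- e ∣ ≡ e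
N-∣N-e∣≡e {N} {e} e≤N = trans (cong (λ d → + N ℤ.- d) (ℤ.0≤i⇒+∣i∣≡i (ℤ.i≤j⇒0≤j-i e≤N))) (N-[N-j]≡j (+ N) e)

coeffL-top : ∀ N f j → coeffL (mkL N f) (+ N ℤ.- + j) ≡ f j
coeffL-top N f j = trans (coeffL-≤ N f (ℤ.i-j≤i (+ N) (+ j))) (cong (f ∘ ℤ.∣_∣) (N-[N-j]≡j (+ N) (+ j)))

-- A record, so that both sides can be inferred from the type of a proof.
infix 4 _≋_
record _≋_ (x y : Laurent) : Set where
  constructor coefficientwise
  field coeff : x ≈L y
open _≋_

≋-refl : ∀ {x} → x ≋ x
≋-refl = coefficientwise (λ _ → refl)

≋-sym : ∀ {x y} → x ≋ y → y ≋ x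
≋-sym h = coefficientwise (λ e → sym (coeff h e))

≋-trans : ∀ {x y z} → x ≋ y → y ≋ z → x ≋ z
≋-trans h k = coefficientwise (λ e → trans (coeff h e) (coeff k e))

mkL-cong : ∀ {M N f g} → M ≡ N → f ≗ g → mkL M f ≋ mkL N g
mkL-cong {M} {f = f} {g} refl h = coefficientwise pointwise
  where
  pointwise : mkL M f ≈L mkL M g
  pointwise e with e ℤ.≤? + M
  ... | yes _ = h _
  ... | no  _ = refl

mkL-injective : ∀ {N f g} → mkL N f ≋ mkL N g → f ≗ g
mkL-injective {N} {f} {g} h j = trans (sym (coeffL-top N f j)) (trans (coeff h (+ N ℤ.- + j)) (coeffL-top N g j))

-- A Laurent series has many representations; leading zeros raise its top, so that several series
-- can be brought to a common one.
mkL-shift : ∀ k {N f} → mkL (k + N) (shift k f) ≋ mkL N f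
mkL-shift zero    = ≋-refl
mkL-shift (suc k) {N} {f} = ≋-trans (coefficientwise step) (mkL-shift k)
  where
  g = shift k f
  M = k + N
  step : mkL (suc M) (shift (suc k) f) ≈L mkL M g
  step e with e ℤ.≤? + suc M | e ℤ.≤? + M
  ... | yes _   | yes e≤M = trans (cong (shift (suc k) f) eq) refl
    where
    eq : ℤ.∣ + suc M ℤ.- e ∣ ≡ suc ℤ.∣ + M ℤ.- e ∣
    eq = ℤ.+-injective (trans (ℤ.0≤i⇒+∣i∣≡i (ℤ.i≤j⇒0≤j-i (ℤ.≤-trans e≤M (ℤ.+≤+ (ℕ.n≤1+n M)))))
      (trans (ℤ.+-assoc (+ 1) (+ M) (ℤ.- e)) (cong (λ d → + 1 ℤ.+ d) (sym (ℤ.0≤i⇒+∣i∣≡i (ℤ.i≤j⇒0≤j-i e≤M))))))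
  -- Only e = M + 1 is left, the position of the added leading zero.
  ... | yes e≤  | no  e≰M rewrite ℤ.≤-antisym e≤ (ℤ.i<j⇒suc[i]≤j (ℤ.≰⇒> e≰M)) =
    cong (shift (suc k) f ∘ ℤ.∣_∣) (ℤ.+-inverseʳ (+ suc M))
  ... | no  e≰  | yes e≤M = ⊥-elim (e≰ (ℤ.≤-trans e≤M (ℤ.+≤+ (ℕ.n≤1+n M))))
  ... | no  _   | no  _   = refl

-- As with cross-multiplied fractions: each series is raised by the top of the other, and at equal
-- tops the coefficients can be compared.
common-top : ∀ {x y} → x ≋ y → shift (top y) (cf x) ≗ shift (top x) (cf y)
common-top {x} {y} h = mkL-injective {top y + top x} (≋-trans (mkL-shift (top y)) (≋-trans h
  (≋-trans (≋-sym (mkL-shift (top x))) (mkL-cong (ℕ.+-comm (top x) (top y)) (λ _ → refl)))))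

coeffL-⊕ : ∀ N f g e → coeffL (mkL N (f ⊕ g)) e ≡ coeffL (mkL N f) e xor coeffL (mkL N g) e
coeffL-⊕ N f g e with e ℤ.≤? + N
... | yes _ = refl
... | no  _ = refl

coeffL-+ : ∀ x y e → coeffL (x +L y) e ≡ coeffL x e xor coeffL y e
coeffL-+ x y e with e ℤ.≤? + (top x ℕ.⊔ top y)
... | yes e≤ = cong (λ e → coeffL x e xor coeffL y e) (N-∣N-e∣≡e e≤)
... | no  e≰ = sym (cong₂ _xor_ (coeffL-> (top x) (cf x) (λ e≤ → e≰ (ℤ.≤-trans e≤
  (ℤ.+≤+ (ℕ.m≤m⊔n (top x) (top y))))))
  (coeffL-> (top y) (cf y) (λ e≤ → e≰ (ℤ.≤-trans e≤ (ℤ.+≤+ (ℕ.m≤n⊔m (top x) (top y)))))))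

+L-cong : ∀ {x x′ y y′} → x ≋ x′ → y ≋ y′ → x +L y ≋ x′ +L y′
+L-cong {x} {x′} {y} {y′} h k = coefficientwise λ e →
  trans (coeffL-+ x y e) (trans (cong₂ _xor_ (coeff h e) (coeff k e)) (sym (coeffL-+ x′ y′ e)))

+L-assoc : ∀ x y z → (x +L y) +L z ≋ x +L (y +L z)
+L-assoc x y z = coefficientwise λ e → begin
  coeffL ((x +L y) +L z) e                   ≡⟨ coeffL-+ (x +L y) z e ⟩
  coeffL (x +L y) e xor coeffL z e           ≡⟨ cong (_xor coeffL z e) (coeffL-+ x y e) ⟩
  (coeffL x e xor coeffL y e) xor coeffL z e ≡⟨ Bool.xor-assoc (coeffL x e) _ _ ⟩
  coeffL x e xor (coeffL y e xor coeffL z e) ≡⟨ cong (coeffL x e xor_) (coeffL-+ y z e) ⟨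
  coeffL x e xor coeffL (y +L z) e           ≡⟨ coeffL-+ x (y +L z) e ⟨
  coeffL (x +L (y +L z)) e ∎
  where open ≡-Reasoning

+L-comm : ∀ x y → x +L y ≋ y +L x
+L-comm x y = coefficientwise λ e →
  trans (coeffL-+ x y e) (trans (Bool.xor-comm (coeffL x e) _) (sym (coeffL-+ y x e)))

coeffL-0 : ∀ e → coeffL zeroL e ≡ false
coeffL-0 e with e ℤ.≤? + 0
... | yes _ = refl
... | no  _ = refl

+L-identityˡ : ∀ x → zeroL +L x ≋ x
+L-identityˡ x = coefficientwise λ e → trans (coeffL-+ zeroL x e) (cong (_xor coeffL x e) (coeffL-0 e))

x+Lx≋0 : ∀ x → x +L x ≋ zeroL
x+Lx≋0 x = coefficientwise λ e → trans (coeffL-+ x x e) (trans (Bool.xor-same (coeffL x e)) (sym (coeffL-0 e)))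

*L-comm : ∀ x y → x *L y ≋ y *L x
*L-comm x y = mkL-cong (ℕ.+-comm (top x) (top y)) (⊛-comm (cf x) (cf y))

*L-assoc : ∀ x y z → (x *L y) *L z ≋ x *L (y *L z)
*L-assoc x y z = mkL-cong (ℕ.+-assoc (top x) (top y) (top z)) (⊛-assoc (cf x) (cf y) (cf z))

*L-congʳ : ∀ {x x′ y} → x ≋ x′ → x *L y ≋ x′ *L y
*L-congʳ {x} {x′} {y} h =
  ≋-trans (≋-sym (mkL-shift (top x′)))
  (≋-trans (mkL-cong (x∙yz≈y∙xz (top x′) (top x) (top y)) λ n →
    trans (sym (shift-⊛ (top x′) (cf x) (cf y) n))
    (trans (⊛-cong {g = cf y} (common-top h) (λ _ → refl) n) (shift-⊛ (top x) (cf x′) (cf y) n)))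
  (mkL-shift (top x)))

*L-cong : ∀ {x x′ y y′} → x ≋ x′ → y ≋ y′ → x *L y ≋ x′ *L y′
*L-cong {x} {x′} {y} {y′} h k = ≋-trans (*L-congʳ {y = y} h)
  (≋-trans (*L-comm x′ y) (≋-trans (*L-congʳ {y = x′} k) (*L-comm y′ x′)))

*L-identityˡ : ∀ x → oneL *L x ≋ x
-- `embedP` uses the length as top, so `oneL` has top 1 and a leading zero: its coefficients are
-- `shift 1 δ`.
*L-identityˡ x = ≋-trans (mkL-cong refl eq) (mkL-shift 1)
  where
  eq : cf oneL ⊛ cf x ≗ shift 1 (cf x)
  eq zero    = refl
  eq (suc n) = trans (⊛-suc (cf oneL) (cf x) n)
    (trans (⊛-cong {g = cf x} (λ { zero → refl ; (suc _) → refl }) (λ _ → refl) n) (⊛-identityˡ (cf x) n))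

raise : ∀ {N x} → top x ≤ N → mkL N (shift (N ∸ top x) (cf x)) ≋ x
raise {N} {x} h = ≋-trans (mkL-cong (sym (ℕ.m∸n+n≡m h)) (λ _ → refl)) (mkL-shift (N ∸ top x))

*L-distribˡ : ∀ x y z → x *L (y +L z) ≋ x *L y +L x *L z
*L-distribˡ x y z = ≋-trans (*L-cong (≋-refl {x}) raised) (coefficientwise λ e →
    trans (coeff (mkL-cong (refl {x = top x + N}) (⊛-distribˡ (cf x) f g)) e)
    (trans (coeffL-⊕ (top x + N) (cf x ⊛ f) (cf x ⊛ g) e)
    (trans (cong₂ _xor_ (coeff (*L-cong (≋-refl {x}) y≋) e) (coeff (*L-cong (≋-refl {x}) z≋) e))
    (sym (coeffL-+ (x *L y) (x *L z) e)))))
  where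
  N = top y ℕ.⊔ top z
  f = shift (N ∸ top y) (cf y)
  g = shift (N ∸ top z) (cf z)
  y≋ : mkL N f ≋ y
  y≋ = raise (ℕ.m≤m⊔n (top y) (top z))
  z≋ : mkL N g ≋ z
  z≋ = raise (ℕ.m≤n⊔m (top y) (top z))
  raised : y +L z ≋ mkL N (f ⊕ g)
  raised = coefficientwise λ e → trans (coeffL-+ y z e)
    (trans (sym (cong₂ _xor_ (coeff y≋ e) (coeff z≋ e))) (sym (coeffL-⊕ N f g e)))

laurentRing : CommutativeRing 0ℓ 0ℓ
laurentRing = record
  { Carrier = Laurent ; _≈_ = _≋_ ; _+_ = _+L_ ; _*_ = _*L_ ; -_ = id ; 0# = zeroL ; 1# = oneL
  ; isCommutativeRing = record
    { isRing = record
      { +-isAbelianGroup = record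
        { isGroup = record
          { isMonoid = record
            { isSemigroup = record
              { isMagma = record
                { isEquivalence = record { refl = ≋-refl ; sym = ≋-sym ; trans = ≋-trans }
                ; ∙-cong = +L-cong }
              ; assoc = +L-assoc }
            ; identity = +L-identityˡ , λ x → ≋-trans (+L-comm x zeroL) (+L-identityˡ x) }
          ; inverse = x+Lx≋0 , x+Lx≋0
          ; ⁻¹-cong = id }
        ; comm = +L-comm }
      ; *-cong = *L-cong
      ; *-assoc = *L-assoc
      ; *-identity = *L-identityˡ , λ x → ≋-trans (*L-comm x oneL) (*L-identityˡ x)
      ; distrib = *L-distribˡ , λ x y z → ≋-trans (*L-comm (y +L z) x)
          (≋-trans (*L-distribˡ x y z) (+L-cong (*L-comm x y) (*L-comm x z)))
      }
    ; *-comm = *L-comm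
    }
  }

-- mkL 0 f is the power series f(1/t), so Ord m x says that x lies in t^(-m) 𝔽₂[[1/t]].
Ord : ℕ → Laurent → Set
Ord m x = ∃[ f ] x ≋ mkL 0 (shift m f)

ord-resp : ∀ {m x y} → x ≋ y → Ord m x → Ord m y
ord-resp h (f , x≋) = f , ≋-trans (≋-sym h) x≋

ord-0 : ∀ {m} → Ord m zeroL
ord-0 {m} = (λ _ → false) , mkL-cong refl (λ n → sym (zeros m n))
  where
  zeros : ∀ m n → shift m (λ _ → false) n ≡ false
  zeros zero    n       = refl
  zeros (suc m) zero    = refl
  zeros (suc m) (suc n) = zeros m n

ord-1 : Ord 0 oneL
ord-1 = δ , ≋-trans (mkL-cong refl λ { zero → refl ; (suc zero) → refl ; (suc (suc _)) → refl }) (mkL-shift 1)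

ord-+ : ∀ {m x y} → Ord m x → Ord m y → Ord m (x +L y)
ord-+ {m} (f , x≋) (g , y≋) = f ⊕ g , ≋-trans (+L-cong x≋ y≋) (coefficientwise λ e →
  trans (coeffL-+ (mkL 0 (shift m f)) (mkL 0 (shift m g)) e)
  (trans (sym (coeffL-⊕ 0 (shift m f) (shift m g) e)) (coeff (mkL-cong (refl {x = 0}) (λ n →
    sym (shift-⊕ m f g n))) e)))

ord-* : ∀ {m n x y} → Ord m x → Ord n y → Ord (m + n) (x *L y)
ord-* {m} {n} (f , x≋) (g , y≋) = f ⊛ g , ≋-trans (*L-cong x≋ y≋) (mkL-cong refl λ i →
  trans (shift-⊛ m f (shift n g) i) (trans (shift-cong m (⊛-shift n f g) i) (sym (shift-+ m n (f ⊛ g) i))))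

ord-weaken : ∀ m {n x} → Ord (m + n) x → Ord m x
ord-weaken m {n} (f , x≋) = shift n f , ≋-trans x≋ (mkL-cong refl (shift-+ m n f))

ord-bounded : ∀ x → ∃[ N ] (∀ {m y} → Ord (N + m) y → Ord m (x *L y))
ord-bounded (mkL N f) = N , λ { {m} (g , y≋) → f ⊛ g , ≋-trans (*L-cong (≋-refl {mkL N f}) y≋)
  (≋-trans (mkL-cong (refl {x = N + 0}) λ i → trans (⊛-cong {f} (λ _ → refl) (shift-+ N m g) i)
    (trans (⊛-shift N f (shift m g) i) (shift-cong N (⊛-shift m f g) i)))
  (mkL-shift N)) }

ord-separated : ∀ {x} → (∀ m → Ord m x) → x ≋ zeroL
ord-separated {x} h = coefficientwise λ e → trans (vanish e) (sym (coeffL-0 e))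
  where
  vanish : ∀ e → coeffL x e ≡ false
  -- For e at most 0 this order exceeds the position of e by one, so the coefficient there is one of
  -- the shifted-in zeros.
  vanish e with h (suc ℤ.∣ + 0 ℤ.- e ∣)
  ... | f , x≋ with e ℤ.≤? + 0
  ... | yes e≤0 =
    trans (coeff x≋ e) (trans (coeffL-≤ 0 (shift (suc ℤ.∣ + 0 ℤ.- e ∣) f) e≤0) (shift-< f (ℕ.n<1+n ℤ.∣ + 0 ℤ.- e ∣)))
  ... | no  e≰0 = trans (coeff x≋ e) (coeffL-> 0 (shift (suc ℤ.∣ + 0 ℤ.- e ∣) f) e≰0)

-- Translates agreement of coefficients, the form of convergence in `IsCFLimit`, into the
-- filtration.
ord-coeff : ∀ m {x} → (∀ e → ℤ.- (+ m) ℤ.≤ e → coeffL x e ≡ false) → Ord m x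
ord-coeff m {x} h = (λ n → g (m + n)) , coefficientwise λ e → trans (eq e) (coeff (mkL-cong
  (refl {x = 0}) (shift-drop m zeros)) e)
  where
  g : Series
  g n = coeffL x (+ 0 ℤ.- + n)
  zeros : ∀ n → n < m → g n ≡ false
  zeros n n<m = h _ (subst (ℤ.- (+ m) ℤ.≤_) (sym (ℤ.+-identityˡ (ℤ.- (+ n)))) (ℤ.neg-mono-≤ (ℤ.+≤+ (ℕ.<⇒≤ n<m))))
  eq : x ≈L mkL 0 g
  eq e with e ℤ.≤? + 0
  ... | yes e≤0 = sym (cong (coeffL x) (N-∣N-e∣≡e e≤0))
  ... | no  e≰0 = h e (ℤ.≤-trans (ℤ.neg-mono-≤ (ℤ.+≤+ (z≤n {m}))) (ℤ.<⇒≤ (ℤ.≰⇒> e≰0)))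

-- The inverse of t^D f is t^(-D) times the quotient of 1 by f, which long division provides as f
-- has constant term 1.
ord-invertible : ∀ {D f x} → f 0 ≡ true → x ≋ mkL D f → ∃[ y ] (Ord D y × x *L y ≋ oneL)
ord-invertible {D} {f} f₀ x≋ = mkL 0 (shift D g) , (g , ≋-refl) ,
    ≋-trans (*L-cong x≋ (≋-refl {mkL 0 (shift D g)}))
    (≋-trans (mkL-cong (refl {x = D + 0}) λ n → trans (⊛-shift D f g n) (shift-cong D (⊛-quotient f f₀ δ) n))
    (≋-trans (mkL-shift D) (≋-sym (proj₂ ord-1))))
  where
  g = quotient f δ

module L = CommutativeRing laurentRing

laurent-char2 : CharacteristicTwo laurentRing
laurent-char2 = x+Lx≋0 oneL

-- Polynomials as Laurent series

if-true : ∀ {b} {x y : Bool} → T b → (if b then x else y) ≡ x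
if-true {true} _ = refl

if-false : ∀ {b} {x y : Bool} → ¬ T b → (if b then x else y) ≡ y
if-false {true}  h = ⊥-elim (h _)
if-false {false} h = refl

coeffP-≥ : ∀ p {n} → length p ≤ n → coeffP p n ≡ false
coeffP-≥ []      _       = refl
coeffP-≥ (_ ∷ p) (s≤s h) = coeffP-≥ p h

coeffP-+ : ∀ p q n → coeffP (p +P q) n ≡ coeffP p n xor coeffP q n
coeffP-+ []      q       n       = refl
coeffP-+ (a ∷ p) []      n       = sym (Bool.xor-identityʳ _)
coeffP-+ (a ∷ p) (b ∷ q) zero    = refl
coeffP-+ (a ∷ p) (b ∷ q) (suc n) = coeffP-+ p q n

embed-coeff : ∀ p n → coeffL (embedP p) (+ n) ≡ coeffP p n
embed-coeff p n with ℕ.≤-<-connex n (length p)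
... | inj₁ n≤ = trans (coeffL-≤ (length p) (cf (embedP p)) (ℤ.+≤+ n≤))
  (trans (cong (cf (embedP p) ∘ ℤ.∣_∣) (trans (ℤ.m-n≡m⊖n (length p) n) (ℤ.⊖-≥ n≤)))
  (trans (if-true (ℕ.≤⇒≤ᵇ (ℕ.m∸n≤m (length p) n))) (cong (coeffP p) (ℕ.m∸[m∸n]≡n n≤))))
... | inj₂ n> = trans (coeffL-> (length p) (cf (embedP p)) {+ n} λ { (ℤ.+≤+ n≤) → ℕ.<⇒≱ n> n≤ })
  (sym (coeffP-≥ p (ℕ.<⇒≤ n>)))

embed-coeff-negative : ∀ p n → coeffL (embedP p) -[1+ n ] ≡ false
embed-coeff-negative p n = trans (coeffL-≤ (length p) (cf (embedP p)) {e = -[1+ n ]} ℤ.-≤+)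
  (if-false λ h → ℕ.m+1+n≰m (length p) (ℕ.≤ᵇ⇒≤ (length p + suc n) (length p) h))

embed-≋ : ∀ p {x} → (∀ n → coeffL x (+ n) ≡ coeffP p n) → (∀ n → coeffL x -[1+ n ] ≡ false) → embedP p ≋ x
embed-≋ p h k = coefficientwise λ
  { (+ n)    → trans (embed-coeff p n) (sym (h n))
  ; -[1+ n ] → trans (embed-coeff-negative p n) (sym (k n)) }

embed-zero : ∀ p → (∀ n → coeffP p n ≡ false) → embedP p ≋ zeroL
embed-zero p h = embed-≋ p (λ n → trans (coeffL-0 (+ n)) (sym (h n))) (λ n → coeffL-0 -[1+ n ])

embed-cong : ∀ p q → p ≈P q → embedP p ≋ embedP q
embed-cong p q h = embed-≋ p (λ n → trans (embed-coeff q n) (sym (h n))) (embed-coeff-negative q)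

embed-+ : ∀ p q → embedP (p +P q) ≋ embedP p +L embedP q
embed-+ p q = embed-≋ (p +P q)
  (λ n → trans (coeffL-+ (embedP p) (embedP q) (+ n))
    (trans (cong₂ _xor_ (embed-coeff p n) (embed-coeff q n)) (sym (coeffP-+ p q n))))
  (λ n → trans (coeffL-+ (embedP p) (embedP q) -[1+ n ]) (cong₂ _xor_ (embed-coeff-negative p n) (embed-coeff-negative q n)))

scalar : Bool → Laurent
scalar b = if b then oneL else zeroL

tL : Laurent
tL = mkL 1 δ

tL-* : ∀ N f → tL *L mkL N f ≋ mkL (suc N) f
tL-* N f = mkL-cong refl (⊛-identityˡ f)

[1+i]-[1+j]≡i-j : ∀ i j → (+ 1 ℤ.+ i) ℤ.- (+ 1 ℤ.+ j) ≡ i ℤ.- j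
[1+i]-[1+j]≡i-j = solve-∀

coeffL-suc : ∀ N f e → coeffL (mkL (suc N) f) (ℤ.suc e) ≡ coeffL (mkL N f) e
coeffL-suc N f e with ℤ.suc e ℤ.≤? + suc N | e ℤ.≤? + N
... | yes _ | yes _ = cong (f ∘ ℤ.∣_∣) ([1+i]-[1+j]≡i-j (+ N) e)
... | yes h | no e≰ = ⊥-elim (e≰ (ℤ.0≤i-j⇒j≤i (subst (+ 0 ℤ.≤_) ([1+i]-[1+j]≡i-j (+ N) e) (ℤ.i≤j⇒0≤j-i h))))
... | no h  | yes e≤ = ⊥-elim (h (ℤ.+-monoʳ-≤ (+ 1) e≤))
... | no _  | no _  = refl

embed-∷ : ∀ a p → embedP (a ∷ p) ≋ scalar a +L tL *L embedP p
embed-∷ a p = L.trans (embed-≋ (a ∷ p) {scalar a +L x} positive negative)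
  (+L-cong (L.refl {scalar a}) (L.sym (tL-* (length p) (cf (embedP p)))))
  where
  x = mkL (suc (length p)) (cf (embedP p))
  scalar-0 : ∀ a → coeffL (scalar a) (+ 0) ≡ a
  scalar-0 true  = refl
  scalar-0 false = refl
  scalar-+ : ∀ a n → coeffL (scalar a) (+ suc n) ≡ false
  scalar-+ true  n = embed-coeff 1P (suc n)
  scalar-+ false n = refl
  scalar-negative : ∀ a n → coeffL (scalar a) -[1+ n ] ≡ false
  scalar-negative true  n = embed-coeff-negative 1P n
  scalar-negative false n = refl
  positive : ∀ n → coeffL (scalar a +L x) (+ n) ≡ coeffP (a ∷ p) n
  positive zero    = trans (coeffL-+ (scalar a) x (+ 0)) (trans (cong₂ _xor_ (scalar-0 a)
    (trans (coeffL-suc (length p) (cf (embedP p)) -[1+ 0 ]) (embed-coeff-negative p 0))) (Bool.xor-identityʳ a))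
  positive (suc n) = trans (coeffL-+ (scalar a) x (+ suc n)) (cong₂ _xor_ (scalar-+ a n)
    (trans (coeffL-suc (length p) (cf (embedP p)) (+ n)) (embed-coeff p n)))
  negative : ∀ n → coeffL (scalar a +L x) -[1+ n ] ≡ false
  negative n = trans (coeffL-+ (scalar a) x -[1+ n ]) (cong₂ _xor_ (scalar-negative a n)
    (trans (coeffL-suc (length p) (cf (embedP p)) -[1+ suc n ]) (embed-coeff-negative p (suc n))))

-- Lists may end in zeros, so their length is not the degree. `D` is the true degree, and `f` begins
-- with the leading coefficient, as division requires.
leading : ∀ p → (∀ n → coeffP p n ≡ false) ⊎
  ∃[ D ] ∃[ f ] (f 0 ≡ true × embedP p ≋ mkL D f × (∀ n → coeffP p n ≡ true → n ≤ D))
leading []      = inj₁ (λ _ → refl)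
leading (a ∷ p) with leading p
leading (true ∷ p) | inj₁ p≡0 = inj₂ (0 , δ , refl , eq , degree)
  where
  eq : embedP (true ∷ p) ≋ mkL 0 δ
  eq = L.trans (embed-≋ (true ∷ p) {oneL}
    (λ { zero → refl ; (suc n) → trans (embed-coeff 1P (suc n))
      (sym (p≡0 n)) }) (embed-coeff-negative 1P)) (proj₂ ord-1)
  degree : ∀ n → coeffP (true ∷ p) n ≡ true → n ≤ 0
  degree zero    _ = z≤n
  degree (suc n) h with trans (sym h) (p≡0 n)
  ... | ()
leading (false ∷ p) | inj₁ p≡0 = inj₁ λ { zero → refl ; (suc n) → p≡0 n }
leading (a ∷ p) | inj₂ (D , f , f₀ , p≋ , degree) = inj₂ (suc D , f ⊕ g , cong (_xor false) f₀ , eq , degree′)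
  where
  -- The constant term `a` sits at position `suc D` below the top and leaves the leading coefficient
  -- of `f` untouched.
  g = shift (suc D) (λ i → a ∧ δ i)
  constant : ∀ a → scalar a ≋ mkL 0 (λ i → a ∧ δ i)
  constant true  = proj₂ ord-1
  constant false = L.refl
  eq : embedP (a ∷ p) ≋ mkL (suc D) (f ⊕ g)
  eq = L.trans (embed-∷ a p) (coefficientwise λ e → begin
    coeffL (scalar a +L tL *L embedP p) e              ≡⟨ coeffL-+ (scalar a) (tL *L embedP p) e ⟩
    coeffL (scalar a) e xor coeffL (tL *L embedP p) e  ≡⟨ cong₂ _xor_ (_≋_.coeff scalar≋ e) (_≋_.coeff tp≋ e) ⟩
    coeffL (mkL (suc D) g) e xor coeffL (mkL (suc D) f) e ≡⟨ Bool.xor-comm (coeffL (mkL (suc D) g) e) _ ⟩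
    coeffL (mkL (suc D) f) e xor coeffL (mkL (suc D) g) e ≡⟨ coeffL-⊕ (suc D) f g e ⟨
    coeffL (mkL (suc D) (f ⊕ g)) e                     ∎)
    where
    open ≡-Reasoning
    scalar≋ : scalar a ≋ mkL (suc D) g
    scalar≋ = L.trans (constant a) (L.trans (L.sym (mkL-shift (suc D))) (mkL-cong (ℕ.+-identityʳ (suc D)) (λ _ → refl)))
    tp≋ : tL *L embedP p ≋ mkL (suc D) f
    tp≋ = L.trans (*L-cong (L.refl {tL}) p≋) (tL-* D f)
  degree′ : ∀ n → coeffP (a ∷ p) n ≡ true → n ≤ suc D
  degree′ zero    _ = z≤n
  degree′ (suc n) h = s≤s (degree n h)

embed-invertible : ∀ p {n} → coeffP p n ≡ true → ∃[ y ] (Ord n y × embedP p *L y ≋ oneL)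
embed-invertible p {n} h with leading p
... | inj₁ p≡0 with trans (sym h) (p≡0 n)
... | ()
embed-invertible p {n} h | inj₂ (D , f , f₀ , p≋ , degree) with ord-invertible f₀ p≋
... | y , ord-y , py≋1 = y , subst (λ k → Ord k y → Ord n y) (ℕ.m+[n∸m]≡n (degree n h)) (ord-weaken n) ord-y , py≋1

zero⊎nonzero : ∀ p → embedP p ≋ zeroL ⊎ NonZeroP p
zero⊎nonzero p with leading p
... | inj₁ p≡0 = inj₁ (embed-zero p p≡0)
... | inj₂ (D , f , f₀ , p≋ , _) = inj₂ (D , trans (sym (embed-coeff p D))
  (trans (_≋_.coeff p≋ (+ D)) (trans (coeffL-≤ D f (ℤ.+≤+ ℕ.≤-refl)) (trans (cong (f ∘ ℤ.∣_∣)
    (ℤ.+-inverseʳ (+ D))) f₀))))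

1≉0 : ¬ oneL ≋ zeroL
1≉0 h with _≋_.coeff h (+ 0)
... | ()

laurent-filtration : Filtration laurentRing _
laurent-filtration = record
  { Ord = Ord ; resp = λ {m} → ord-resp {m} ; 0∈ = λ {m} → ord-0 {m} ; 1∈ = ord-1
  ; +∈ = λ {m} → ord-+ {m} ; *∈ = λ {m} {n} → ord-* {m} {n}
  ; weaken = ord-weaken ; bounded = ord-bounded ; separated = ord-separated ; unit = unit }
  where
  unit : ∀ {x} → Ord 1 x → ∃[ y ] (oneL +L x) *L y ≋ oneL
  unit {x} (f , x≋) with ord-invertible {0} {δ ⊕ shift 1 f} {oneL +L x} refl (coefficientwise λ e →
    trans (coeffL-+ oneL x e)
    (trans (cong₂ _xor_ (_≋_.coeff (proj₂ ord-1) e) (_≋_.coeff x≋ e)) (sym (coeffL-⊕ 0 δ (shift 1 f) e))))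
  ... | y , _ , h = y , h

laurent-embedding : PolynomialEmbedding laurent-filtration
laurent-embedding = record
  { embed = embedP ; t = tL ; embed-cong = embed-cong ; embed-[] = embed-zero [] (λ _ → refl) ; embed-1 = L.refl
  ; embed-∷ = λ { true → embed-∷ true ; false → embed-∷ false }
  ; embed-+ = embed-+ ; embed-invertible = embed-invertible ; zero⊎nonzero = zero⊎nonzero ; 1≉0 = 1≉0 }

-- Translation to the definitions of the statement

module LC = CharTwo laurentRing laurent-char2
module LF = PolynomialFractions laurent-char2 laurent-embedding

toRepresents : ∀ r x → LF.Represents x r → Represents x r
toRepresents _ _ (q≢0 , h) = q≢0 , _≋_.coeff h

fromRepresents : ∀ r x → Represents x r → LF.Represents x r
fromRepresents _ _ (q≢0 , h) = q≢0 , coefficientwise h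

sumL≡sum : ∀ n f → sumL n f ≡ LC.sum n f
sumL≡sum zero    f = refl
sumL≡sum (suc n) f = cong (_+L f n) (sumL≡sum n f)

powL≡^ : ∀ x n → powL x n ≡ x LC.^ n
powL≡^ x zero    = refl
powL≡^ x (suc n) = cong (_*L x) (powL≡^ x n)

sumL-≋ : ∀ n {f g : ℕ → Laurent} → (∀ i → f i ≡ g i) → sumL n f ≋ LC.sum n g
sumL-≋ n {f} {g} h = L.trans (L.reflexive (sumL≡sum n f)) (LC.sum-cong n λ i _ → L.reflexive (h i))

cfLimit : ∀ {ε} (nonConst : ∀ n → NonConst (ε n)) {α} → IsCFLimit (sSeq ε) α →
  LF.ContinuedFraction.IsLimit ε nonConst α
cfLimit {ε} nonConst {α} limit m with limit m
... | N , close = N , λ n N≤n x x-rep → ord-coeff m λ e -m≤e → trans (coeffL-+ x α e)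
  (trans (cong (_xor coeffL α e) (close n N≤n x (toRepresents (convergent (sSeq ε) n) x x-rep) e -m≤e)) (Bool.xor-same (coeffL α e)))

mainTheorem1 : (l d : ℕ) (ε : ℕ → Poly) →
    (∀ i → NonConst (ε i)) → UltPeriodic l d ε →
    (α : Laurent) → IsCFLimit (sSeq ε) α →
    (Σ[ P ∈ (ℕ → RatF) ] ((∀ i → i ≤ 2 ^ d → InF ε (l + d) (P i))
    × NonZeroP (proj₁ (P (2 ^ d)))
    × (∀ (c : ℕ → Laurent) → (∀ i → i ≤ 2 ^ d → Represents (c i) (P i)) →
    sumL (suc (2 ^ d)) (λ i → c i *L powL α i) ≈L zeroL)))
    ×
    (∀ (β : Laurent) → α *L β ≈L oneL →
    Σ[ A ∈ RatF ] Σ[ B ∈ (ℕ → RatF) ] (InF ε (l + d) A × (∀ k → k < d → InF ε (l + d) (B k))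
    × (∀ (a : Laurent) (b : ℕ → Laurent) → Represents a A →
    (∀ k → k < d → Represents (b k) (B k)) →
    powL β (2 ^ d) ≈L a +L sumL d (λ k → b k *L powL β (2 ^ k)))))
mainTheorem1 l d ε nonConst ultPeriodic α limit = conclude (CF.limit-equation ultPeriodic (cfLimit nonConst limit))
  where
  module CF = LF.ContinuedFraction ε nonConst
  F = LF.Value ε (l + d)
  conclude : ∃[ A ] Σ[ B ∈ (ℕ → Laurent) ] (F A × (∀ k → F (B k)) ×
    A *L α LC.^ (2 ^ d) +L LC.sum d (λ k → B k *L α LC.^ (2 ^ d ∸ 2 ^ k)) ≋ oneL) → _
  -- The identity `eq` in `α` serves both halves: as a polynomial equation, and divided by `α` to
  -- the power 2^d once `β` is given.
  conclude (A , B , A∈ , B∈ , eq) = annihilator (CF.vanishing-fractions ultPeriodic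
      (LC.Linear.reciprocal-polynomial (LF.value-subfield ε (l + d)) d A∈ B∈ eq)) ,
    λ β αβ≈1 → proj₁ A∈ , proj₁ ∘ B∈ , proj₁ (proj₂ A∈) , (λ k _ → proj₁ (proj₂ (B∈ k))) , λ a b a-rep b-rep →
      _≋_.coeff (L.trans (L.reflexive (powL≡^ β (2 ^ d)))
        (L.trans (CF.reciprocal-fractions ultPeriodic A∈ B∈ eq (coefficientwise αβ≈1)
          (fromRepresents (proj₁ A∈) a a-rep) (λ k k<d → fromRepresents (proj₁ (B∈ k)) (b k) (b-rep k k<d)))
        (+L-cong (L.refl {a}) (L.sym (sumL-≋ d (λ k → cong (b k *L_) (powL≡^ β (2 ^ k))))))))
    where
    annihilator : Σ[ P ∈ (ℕ → RatF) ] ((∀ i → InF ε (l + d) (P i)) × NonZeroP (proj₁ (P (2 ^ d))) ×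
        (∀ (c : ℕ → Laurent) → (∀ i → i ≤ 2 ^ d → LF.Represents (c i) (P i)) →
          LC.sum (suc (2 ^ d)) (λ i → c i *L α LC.^ i) ≋ zeroL)) → _
    annihilator (P , P∈ , top , root) = P , (λ i _ → P∈ i) , top , λ c c-rep →
      _≋_.coeff (L.trans (sumL-≋ (suc (2 ^ d)) (λ i → cong (c i *L_) (powL≡^ α i)))
        (root c (λ i i≤ → fromRepresents (P i) (c i) (c-rep i i≤))))
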